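{- Let $G$ be a graph on $n$ vertices of diameter at most $4$. Then $c(G)<n^{\frac{3}{5}+o(1)}$, where $o(1)$ denotes a quantity tending to $0$ as $n\to\infty$.
   Context: Cops and Robbers on a graph $G$: first each of $k$ cops chooses an initial vertex, then the robber chooses an initial vertex. Then the players alternate, starting with the cops: in a cops' turn every cop either stays at its vertex or moves to an adjacent vertex, and in the robber's turn the robber stays or moves to an adjacent vertex. Several cops may occupy the same vertex, and both players have full information. The cops win if, whatever the robber does, after some cops' move some cop occupies the robber's vertex. The cop number $c(G)$ is the least $k$ for which the cops win. -}

module Defs where

open import Data.Nat using (ℕ; zero; suc; _<_)
open import Data.Fin using (Fin)
open import Data.Product using (Σ; ∃; ∃-syntax; _×_)
open import Data.Sum using (_⊎_)
open import Relation.Binary.PropositionalEquality using (_≡_)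
open import Relation.Nullary using (¬_)

record Graph (n : ℕ) : Set₁ where
  field
    Adj   : Fin n → Fin n → Set
    sym   : ∀ {u v} → Adj u v → Adj v u
    irrfl : ∀ {u} → ¬ Adj u u
open Graph public

data Reach {n : ℕ} (G : Graph n) : ℕ → Fin n → Fin n → Set where
  here : ∀ {d u} → Reach G d u u
  step : ∀ {d u w v} → Adj G u w → Reach G d w v → Reach G (suc d) u v

DiamAtMost : ∀ {n} → Graph n → ℕ → Set
DiamAtMost G d = ∀ u v → Reach G d u v

StepOrStay : ∀ {n} → Graph n → Fin n → Fin n → Set
StepOrStay G x y = x ≡ y ⊎ Adj G x y

Cops : ℕ → ℕ → Set
Cops k n = Fin k → Fin n

CopsMove : ∀ {n k} → Graph n → Cops k n → Cops k n → Set
CopsMove G c c' = ∀ i → StepOrStay G (c i) (c' i)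

Caught : ∀ {n k} → Cops k n → Fin n → Set
Caught c r = ∃[ i ] c i ≡ r

-- WinFrom G c r : cops at c, robber at r, cops to move; the cops can force
-- a capture (after some cops' move) in finitely many rounds whatever the
-- robber does (inductive attractor of the game).
data WinFrom {n k : ℕ} (G : Graph n) : Cops k n → Fin n → Set where
  win : ∀ {c r} (c' : Cops k n) → CopsMove G c c' →
        (Caught c' r ⊎ (∀ r' → StepOrStay G r r' → WinFrom G c' r')) →
        WinFrom G c r

CopsWin : ∀ {n} → Graph n → ℕ → Set
CopsWin {n} G k = Σ (Cops k n) λ c → ∀ r → WinFrom G c r

IsCopNumber : ∀ {n} → Graph n → ℕ → Set
IsCopNumber G c = CopsWin G c × (∀ k → k < c → ¬ CopsWin G k)

{-# OPTIONS --safe #-}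
module Submission where

open import Defs
open import Data.Nat using (ℕ; suc; _+_; _*_; _^_; _≤_; _<_)
open import Data.Product using (∃-syntax)

open import Data.Bool using (Bool; true; false; _∧_; _∨_; not)
open import Data.Bool.Properties using (∨-zeroʳ) renaming (_≟_ to _≟ᵇ_)
open import Data.Empty using (⊥; ⊥-elim)
open import Data.Fin using (Fin; zero; suc; fromℕ<)
open import Data.Fin.Properties using (any?) renaming (_≟_ to _≟ᶠ_)
open import Data.List using
  (List; []; _∷_; _++_; length; map; filter; replicate; allFin; tabulate; lookup; cartesianProductWith)
open import Data.List.Properties using
  (length-++; length-map; length-replicate; length-filter; filter-notAll; filter-reject; ++-assoc;
   ++-identityʳ; filter-++; tabulate-lookup; length-tabulate)
open import Data.List.Membership.Propositional using (_∈_; _∉_)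
open import Data.List.Membership.Propositional.Properties using
  (∈-++⁺ˡ; ∈-++⁺ʳ; ∈-filter⁺; ∈-filter⁻; ∈-allFin; ∈-cartesianProductWith⁺)
open import Data.List.Relation.Binary.Pointwise using
  (Pointwise; []; _∷_) renaming (refl to Pointwise-refl; ++⁺ to Pointwise-++⁺)
open import Data.List.Relation.Unary.Any using (Any; here; there) renaming (any? to anyList?)
open import Data.Nat using (zero; _∸_; z≤n; s≤s; _≤?_; _<?_; NonZero; >-nonZero; _/_; _%_)
open import Data.Nat.DivMod using (m/n*n≤m; m≡m%n+[m/n]*n; m%n<n)
open import Data.Nat.Properties
open import Data.Nat.Tactic.RingSolver using (solve-∀)
open import Data.Product using (_×_; _,_; proj₁; proj₂)
open import Data.Sum using (_⊎_; inj₁; inj₂; [_,_]′)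
open import Data.Unit using (⊤; tt)
open import Data.Vec using (Vec; []; _∷_)
open import Function using (_∘_; case_of_)
open import Relation.Binary.PropositionalEquality using
  (_≡_; refl; trans; cong; cong₂; subst) renaming (sym to ≡-sym)
open import Relation.Nullary using (¬_; Dec; yes; no; does)
open import Relation.Nullary.Decidable using
  (dec-true; _×-dec_; _⊎-dec_; ¬?; map′; ¬¬-excluded-middle; decidable-stable)
import Data.List.Relation.Unary.Any as Any
import Data.List.Relation.Unary.Any.Properties as Any
open import Algebra.Properties.CommutativeMonoid.Sum +-0-commutativeMonoid using (sum; sum-cong-≗; ∑-distrib-+)

-- All quantities are measured in powers of b ≈ n^ε. Place about n^(3/5) cops so that, for r = 2, 3, every set A of
-- vertices whose r-ball meets at most b|A| cops has an r-ball of size at most P|A|, where P ≈ n^(2/5); such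
-- positions exist by a union bound, derandomised greedily. A constant number of teams starts from these positions.
-- Matching cops greedily to the places A the robber may be in after r - 1 moves guards all of A except a set S with a
-- small r-ball, so the robber may be assumed to go to S.
-- Suppose the robber at v₀ is known to have at most D₁ choices for v₁ and then at most D₂ choices for v₂. Confine
-- v₁ to S₁ and v₂ to S₂(v₁), and let F(w) be the neighbourhood of S₂(w). For e = bᵏ choose greedily at most P D₁ / e
-- vertices w ∈ S₁ such that their union W of sets F(w) contains every F(w), w ∈ S₁, up to fewer than e vertices.
-- For some k, v₃ lies in the W of bᵏ but not in that of bᵏ⁺¹. The first fact confines v₄ to (P D₁ / e) · P D₂
-- vertices, the second confines v₅, as seen from v₁, to P b e vertices. As the diameter is at most 4, within four
-- moves one team occupies vertices dominating all of such a set but a part in which every vertex has few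
-- neighbours, namely at most the size of the set divided by the number q of cops in a team. Hence from v₃ the
-- product of the two numbers of choices is at most D₁ D₂ P³ b / q² ≤ D₁ D₂ / b, and after a bounded number of
-- rounds no choice is left.

-- Finite sets of vertices

sum-mono : ∀ {n} {f g : Fin n → ℕ} → (∀ i → f i ≤ g i) → sum f ≤ sum g
sum-mono {zero}  f≤g = z≤n
sum-mono {suc n} f≤g = +-mono-≤ (f≤g zero) (sum-mono (f≤g ∘ suc))

sum-≤-const : ∀ {n} {f : Fin n → ℕ} m → (∀ i → f i ≤ m) → sum f ≤ n * m
sum-≤-const {zero}  m f≤m = z≤n
sum-≤-const {suc n} m f≤m = +-mono-≤ (f≤m zero) (sum-≤-const m (f≤m ∘ suc))

pigeonhole-sum : ∀ {n} (f : Fin (suc n) → ℕ) m → suc n * m ≤ sum f → ∃[ i ] m ≤ f i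
pigeonhole-sum f m m≤ with m ≤? f zero
... | yes m≤f₀ = zero , m≤f₀
pigeonhole-sum {zero}  f m m≤ | no m≰f₀ =
  ⊥-elim (m≰f₀ (subst (m ≤_) (+-identityʳ (f zero)) (≤-trans (m≤m+n m 0) m≤)))
pigeonhole-sum {suc n} f m m≤ | no m≰f₀ =
  let (i , m≤fᵢ) = pigeonhole-sum (f ∘ suc) m (+-cancelˡ-≤ m _ _
                     (≤-trans m≤ (+-monoˡ-≤ (sum (f ∘ suc)) (<⇒≤ (≰⇒> m≰f₀)))))
  in suc i , m≤fᵢ

does⁻ : ∀ {a} {A : Set a} (a? : Dec A) → does a? ≡ true → A
does⁻ (yes a) _ = a

bit : Bool → ℕ
bit false = 0
bit true  = 1

VSet : ℕ → Set
VSet n = Fin n → Bool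

module _ {n : ℕ} where

  open import Data.List.Membership.DecPropositional (_≟ᶠ_ {n}) using (_∈?_) public

  infix 4 _∈ˢ_ _∉ˢ_ _⊆ˢ_
  infixr 6 _∪_ _∩_ _∖_

  -- A record instead of the bare equation, so that `v` and `X` can be inferred from the type of a
  -- membership proof.
  record _∈ˢ_ (v : Fin n) (X : VSet n) : Set where
    constructor is-in
    field holds : X v ≡ true

  record _∉ˢ_ (v : Fin n) (X : VSet n) : Set where
    constructor not-in
    field fails : X v ≡ false

  _⊆ˢ_ : VSet n → VSet n → Set
  X ⊆ˢ Y = ∀ {v} → v ∈ˢ X → v ∈ˢ Y

  ∅ : VSet n
  ∅ _ = false

  full : VSet n
  full _ = true

  _∪_ _∩_ _∖_ : VSet n → VSet n → VSet n
  (X ∪ Y) v = X v ∨ Y v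
  (X ∩ Y) v = X v ∧ Y v
  (X ∖ Y) v = X v ∧ not (Y v)

  ⟦_⟧ : List (Fin n) → VSet n
  ⟦ A ⟧ v = does (v ∈? A)

  _∈ˢ?_ : ∀ v X → Dec (v ∈ˢ X)
  v ∈ˢ? X = map′ is-in _∈ˢ_.holds (X v ≟ᵇ true)

  members : VSet n → List (Fin n) → List (Fin n)
  members X = filter (_∈ˢ? X)

  absurd-∉ : ∀ {ℓ} {W : Set ℓ} {v X} → v ∈ˢ X → v ∉ˢ X → W
  absurd-∉ (is-in v∈X) (not-in v∉X) with () ← trans (≡-sym v∈X) v∉X

  ∈∨∉ : ∀ v X → v ∈ˢ X ⊎ v ∉ˢ X
  ∈∨∉ v X with X v in eq
  ... | true  = inj₁ (is-in eq)
  ... | false = inj₂ (not-in eq)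

  ∪⁺ˡ : ∀ X Y → X ⊆ˢ (X ∪ Y)
  ∪⁺ˡ X Y {v} (is-in v∈X) = is-in (cong (_∨ Y v) v∈X)

  ∪⁺ʳ : ∀ X Y → Y ⊆ˢ (X ∪ Y)
  ∪⁺ʳ X Y {v} (is-in v∈Y) = is-in (trans (cong (X v ∨_) v∈Y) (∨-zeroʳ (X v)))

  ∪⁻ : ∀ X Y {v} → v ∈ˢ X ∪ Y → v ∈ˢ X ⊎ v ∈ˢ Y
  ∪⁻ X Y {v} (is-in v∈) with X v in eq
  ... | true  = inj₁ (is-in eq)
  ... | false = inj₂ (is-in v∈)

  ∩⁺ : ∀ X Y {v} → v ∈ˢ X → v ∈ˢ Y → v ∈ˢ X ∩ Y
  ∩⁺ X Y (is-in v∈X) (is-in v∈Y) = is-in (cong₂ _∧_ v∈X v∈Y)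

  ∩⁻ : ∀ X Y {v} → v ∈ˢ X ∩ Y → v ∈ˢ X × v ∈ˢ Y
  ∩⁻ X Y {v} (is-in v∈) with true ← X v in eq = is-in eq , is-in v∈

  ∖⁺ : ∀ X Y {v} → v ∈ˢ X → v ∉ˢ Y → v ∈ˢ X ∖ Y
  ∖⁺ X Y (is-in v∈X) (not-in v∉Y) = is-in (cong₂ (λ x y → x ∧ not y) v∈X v∉Y)

  ∖⁻ : ∀ X Y {v} → v ∈ˢ X ∖ Y → v ∈ˢ X × v ∉ˢ Y
  ∖⁻ X Y {v} (is-in v∈) with true ← X v in eq | false ← Y v in eq′ = is-in eq , not-in eq′

  ⟦⟧⁺ : ∀ A {v} → v ∈ A → v ∈ˢ ⟦ A ⟧
  ⟦⟧⁺ A {v} v∈A = is-in (dec-true (v ∈? A) v∈A)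

  ⟦⟧⁻ : ∀ A {v} → v ∈ˢ ⟦ A ⟧ → v ∈ A
  ⟦⟧⁻ A {v} (is-in v∈) = does⁻ (v ∈? A) v∈

  count : VSet n → ℕ
  count X = sum (bit ∘ X)

  count-mono : ∀ {X Y} → X ⊆ˢ Y → count X ≤ count Y
  count-mono {X} {Y} X⊆Y = sum-mono bit-mono
    where
    bit-mono : ∀ v → bit (X v) ≤ bit (Y v)
    bit-mono v with X v in v∈X
    ... | false = z≤n
    ... | true rewrite _∈ˢ_.holds (X⊆Y (is-in v∈X)) = ≤-refl

  count≤n : ∀ X → count X ≤ n
  count≤n X = subst (count X ≤_) (*-identityʳ n) (sum-≤-const 1 bit≤1)
    where
    bit≤1 : ∀ v → bit (X v) ≤ 1
    bit≤1 v with X v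
    ... | false = z≤n
    ... | true  = ≤-refl

  count-empty : ∀ X → (∀ {v} → ¬ v ∈ˢ X) → count X ≤ 0
  count-empty X empty = subst (count X ≤_) (*-zeroʳ n) (sum-≤-const {f = bit ∘ X} 0 bit≤0)
    where
    bit≤0 : ∀ v → bit (X v) ≤ 0
    bit≤0 v with X v in eq
    ... | false = z≤n
    ... | true  = ⊥-elim (empty (is-in eq))

  count-∪ : ∀ X Y → count (X ∪ Y) ≤ count X + count Y
  count-∪ X Y = ≤-trans (sum-mono bit-∪) (≤-reflexive (∑-distrib-+ (bit ∘ X) (bit ∘ Y)))
    where
    bit-∪ : ∀ v → bit (X v ∨ Y v) ≤ bit (X v) + bit (Y v)
    bit-∪ v with X v
    ... | false = ≤-refl
    ... | true  = s≤s z≤n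

  count-split : ∀ X Y → count X ≡ count (X ∩ Y) + count (X ∖ Y)
  count-split X Y = trans (sum-cong-≗ bit-split) (∑-distrib-+ (bit ∘ (X ∩ Y)) (bit ∘ (X ∖ Y)))
    where
    bit-split : ∀ v → bit (X v) ≡ bit (X v ∧ Y v) + bit (X v ∧ not (Y v))
    bit-split v with X v | Y v
    ... | false | _     = refl
    ... | true  | true  = refl
    ... | true  | false = refl

length-filter-tabulate : ∀ {m n} (X : VSet m) (g : Fin n → Fin m) →
                         length (members X (tabulate g)) ≡ count (X ∘ g)
length-filter-tabulate {n = zero}  X g = refl
length-filter-tabulate {n = suc n} X g with X (g zero)
... | true  = cong suc (length-filter-tabulate X (g ∘ suc))
... | false = length-filter-tabulate X (g ∘ suc)

count-singleton : ∀ {n} (v : Fin n) → count ⟦ v ∷ [] ⟧ ≤ 1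
count-singleton {suc n} zero = subst (λ k → suc k ≤ 1) (≡-sym (n≤0⇒n≡0 rest)) ≤-refl
  where
  rest : count {n} (λ i → ⟦ zero ∷ [] ⟧ (suc i)) ≤ 0
  rest = count-empty {n} _ λ { {v} (is-in v∈) →
           case ⟦⟧⁻ (zero ∷ []) {suc v} (is-in v∈) of λ { (here ()) ; (there ()) } }
count-singleton (suc v) = ≤-trans (count-mono sub) (count-singleton v)
  where
  sub : (λ i → ⟦ suc v ∷ [] ⟧ (suc i)) ⊆ˢ ⟦ v ∷ [] ⟧
  sub {i} (is-in i∈) with here refl ← ⟦⟧⁻ (suc v ∷ []) {suc i} (is-in i∈) = ⟦⟧⁺ (v ∷ []) (here refl)

module _ {n : ℕ} where

  elements : VSet n → List (Fin n)
  elements X = members X (allFin n)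

  length-elements : ∀ X → length (elements X) ≡ count X
  length-elements X = length-filter-tabulate X (λ i → i)

  ∈-elements⁺ : ∀ {X v} → v ∈ˢ X → v ∈ elements X
  ∈-elements⁺ {X} {v} v∈X = ∈-filter⁺ (_∈ˢ? X) (∈-allFin v) v∈X

  ∈-elements⁻ : ∀ {X v} → v ∈ elements X → v ∈ˢ X
  ∈-elements⁻ {X} v∈ = proj₂ (∈-filter⁻ (_∈ˢ? X) {xs = allFin n} v∈)

  count-⟦⟧ : (A : List (Fin n)) → count ⟦ A ⟧ ≤ length A
  count-⟦⟧ []      = count-empty {n} ⟦ [] ⟧ λ v∈ → case ⟦⟧⁻ [] v∈ of λ ()
  count-⟦⟧ (a ∷ A) = begin
    count ⟦ a ∷ A ⟧                    ≤⟨ count-mono sub ⟩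
    count (⟦ a ∷ [] ⟧ ∪ ⟦ A ⟧)         ≤⟨ count-∪ ⟦ a ∷ [] ⟧ ⟦ A ⟧ ⟩
    count ⟦ a ∷ [] ⟧ + count ⟦ A ⟧     ≤⟨ +-mono-≤ (count-singleton a) (count-⟦⟧ A) ⟩
    suc (length A)                     ∎
    where
    open ≤-Reasoning
    sub : ⟦ a ∷ A ⟧ ⊆ˢ (⟦ a ∷ [] ⟧ ∪ ⟦ A ⟧)
    sub v∈ with ⟦⟧⁻ (a ∷ A) v∈
    ... | here refl = ∪⁺ˡ ⟦ a ∷ [] ⟧ ⟦ A ⟧ (⟦⟧⁺ (a ∷ []) (here refl))
    ... | there v∈A = ∪⁺ʳ ⟦ a ∷ [] ⟧ ⟦ A ⟧ (⟦⟧⁺ A v∈A)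

  ⋃ : (Fin n → VSet n) → List (Fin n) → VSet n
  ⋃ F []       = ∅
  ⋃ F (w ∷ ws) = F w ∪ ⋃ F ws

  ⋃⁻ : ∀ F ws {v} → v ∈ˢ ⋃ F ws → ∃[ w ] w ∈ ws × v ∈ˢ F w
  ⋃⁻ F (w ∷ ws) v∈ with ∪⁻ (F w) (⋃ F ws) v∈
  ... | inj₁ v∈Fw = w , here refl , v∈Fw
  ... | inj₂ v∈⋃  = let (w′ , w′∈ , v∈′) = ⋃⁻ F ws v∈⋃ in w′ , there w′∈ , v∈′

  ⋃⁺ : ∀ F {ws w v} → w ∈ ws → v ∈ˢ F w → v ∈ˢ ⋃ F ws
  ⋃⁺ F {w ∷ ws} (here refl) v∈ = ∪⁺ˡ (F w) (⋃ F ws) v∈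
  ⋃⁺ F {w ∷ ws} (there w∈)  v∈ = ∪⁺ʳ (F w) (⋃ F ws) (⋃⁺ F w∈ v∈)

  count-⋃ : ∀ {F} m ws → (∀ w → count (F w) ≤ m) → count (⋃ F ws) ≤ length ws * m
  count-⋃ m []       F≤m = count-empty {n} ∅ λ ()
  count-⋃ {F} m (w ∷ ws) F≤m =
    ≤-trans (count-∪ (F w) (⋃ F ws)) (+-mono-≤ (F≤m w) (count-⋃ m ws F≤m))

  abstract
    -- A vertex is chosen only if its set adds at least `e` new elements to the union built so far,
    -- which gives the lower bound on the union. A skipped set has fewer than `e` elements outside
    -- the union, and this stays true as the union grows. A chosen set has none outside, hence the
    -- condition `0 < e`.
    greedy-cover : ∀ (F : Fin n → VSet n) e A →
      ∃[ ws ] (∀ {w} → w ∈ ws → w ∈ A) × length ws * e ≤ count (⋃ F ws) ×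
        (∀ {w} → w ∈ A → 0 < e → count (F w ∖ ⋃ F ws) < e)
    greedy-cover F e [] = [] , (λ ()) , z≤n , λ ()
    greedy-cover F e (a ∷ A) with greedy-cover F e A
    ... | ws , ws⊆A , e≤ , small with count (F a ∖ ⋃ F ws) <? e
    ... | yes a-small = ws , (λ w∈ → there (ws⊆A w∈)) , e≤ ,
                        λ { (here refl) _ → a-small ; (there w∈) → small w∈ }
    ... | no  a-large = a ∷ ws , (λ { (here refl) → here refl ; (there w∈) → there (ws⊆A w∈) }) ,
      (begin
        e + length ws * e                             ≤⟨ +-mono-≤ (≮⇒≥ a-large) e≤ ⟩
        count (F a ∖ U) + count U                     ≤⟨ +-mono-≤ (count-mono new) (count-mono old) ⟩
        count (U′ ∖ U) + count (U′ ∩ U)               ≡⟨ +-comm (count (U′ ∖ U)) _ ⟩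
        count (U′ ∩ U) + count (U′ ∖ U)               ≡⟨ count-split U′ U ⟨
        count U′                                      ∎) , small′
      where
      open ≤-Reasoning
      U U′ : VSet n
      U = ⋃ F ws
      U′ = F a ∪ U
      new : (F a ∖ U) ⊆ˢ (U′ ∖ U)
      new v∈ = let (v∈Fa , v∉U) = ∖⁻ (F a) U v∈ in ∖⁺ U′ U (∪⁺ˡ (F a) U v∈Fa) v∉U
      old : U ⊆ˢ (U′ ∩ U)
      old v∈U = ∩⁺ U′ U (∪⁺ʳ (F a) U v∈U) v∈U
      small′ : ∀ {w} → w ∈ a ∷ A → 0 < e → count (F w ∖ U′) < e
      small′ (here refl) 0<e = ≤-<-trans (count-empty (F a ∖ U′) none) 0<e
        where
        none : ∀ {v} → ¬ v ∈ˢ F a ∖ U′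
        none v∈ = let (v∈Fa , v∉U′) = ∖⁻ (F a) U′ v∈
                  in absurd-∉ {X = U′} (∪⁺ˡ (F a) U v∈Fa) v∉U′
      small′ {w} (there w∈) 0<e = ≤-<-trans (count-mono shrink) (small w∈ 0<e)
        where
        shrink : (F w ∖ U′) ⊆ˢ (F w ∖ U)
        shrink {v} v∈ with ∖⁻ (F w) U′ v∈ | ∈∨∉ v U
        ... | v∈Fw , v∉U′ | inj₁ v∈U = absurd-∉ {X = U′} (∪⁺ʳ (F a) U v∈U) v∉U′
        ... | v∈Fw , v∉U′ | inj₂ v∉U = ∖⁺ (F w) U v∈Fw v∉U

-- Cop positions that expand well

length-cartesianProductWith : ∀ {A B C : Set} (f : A → B → C) xs ys →
                              length (cartesianProductWith f xs ys) ≡ length xs * length ys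
length-cartesianProductWith f []       ys = refl
length-cartesianProductWith f (x ∷ xs) ys =
  trans (length-++ (map (f x) ys)) (cong₂ _+_ (length-map (f x) ys) (length-cartesianProductWith f xs ys))

module _ {n : ℕ} where

  containing missing : Fin n → List (VSet n) → List (VSet n)
  containing v = filter (v ∈ˢ?_)
  missing    v = filter (λ X → ¬? (v ∈ˢ? X))

  length-containing+missing : ∀ v 𝓕 → length (containing v 𝓕) + length (missing v 𝓕) ≡ length 𝓕
  length-containing+missing v [] = refl
  length-containing+missing v (X ∷ 𝓕) with X v
  ... | true  = cong suc (length-containing+missing v 𝓕)
  ... | false = trans (+-suc _ _) (cong suc (length-containing+missing v 𝓕))

  -- Counts the pairs of a vertex and a set containing it in two ways. With `pigeonhole-sum` it
  -- yields a vertex lying in at least a `1/R` share of the sets.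
  double-count : ∀ R 𝓕 → (∀ {X} → X ∈ 𝓕 → n ≤ R * count X) →
                 n * length 𝓕 ≤ sum (λ v → R * length (containing v 𝓕))
  double-count R [] large = ≤-trans (≤-reflexive (*-zeroʳ n)) z≤n
  double-count R (X ∷ 𝓕) large = begin
    n * suc (length 𝓕)                                         ≡⟨ *-suc n _ ⟩
    n + n * length 𝓕                                           ≤⟨ +-mono-≤ (large (here refl)) (double-count R 𝓕 (large ∘ there)) ⟩
    R * count X + sum (λ v → R * length (containing v 𝓕))      ≡⟨ cong (_+ _) (sum-* R (bit ∘ X)) ⟩
    sum (λ v → R * bit (X v)) + sum (λ v → R * length (containing v 𝓕)) ≡⟨ ∑-distrib-+ {n} (λ v → R * bit (X v)) _ ⟨
    sum (λ v → R * bit (X v) + R * length (containing v 𝓕))    ≡⟨ sum-cong-≗ add ⟩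
    sum (λ v → R * length (containing v (X ∷ 𝓕)))              ∎
    where
    open ≤-Reasoning
    sum-* : ∀ {m} R (f : Fin m → ℕ) → R * sum f ≡ sum (λ i → R * f i)
    sum-* {zero}  R f = *-zeroʳ R
    sum-* {suc m} R f = trans (*-distribˡ-+ R (f zero) _) (cong (R * f zero +_) (sum-* R (f ∘ suc)))
    add : ∀ v → R * bit (X v) + R * length (containing v 𝓕) ≡ R * length (containing v (X ∷ 𝓕))
    add v with X v
    ... | true  = ≡-sym (*-distribˡ-+ R 1 (length (containing v 𝓕)))
    ... | false = cong (_+ R * length (containing v 𝓕)) (*-zeroʳ R)

  Hits : List (Fin n) → VSet n → Set
  Hits H X = ∃[ v ] v ∈ H × v ∈ˢ X

  -- Each pick hits at least a 1/R share of the sets still missed.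
  greedy-hitting : 0 < n → ∀ R m i (𝓕 : List (VSet n)) → (∀ {X} → X ∈ 𝓕 → n ≤ R * count X) →
    ∃[ H ] ∃[ 𝓖 ] length H ≤ i × (∀ {X} → X ∈ 𝓕 → Hits H X ⊎ X ∈ 𝓖) × (∀ {X} → X ∈ 𝓖 → X ∈ 𝓕) ×
      (length 𝓖 < m ⊎ i * m + R * length 𝓖 ≤ R * length 𝓕)
  greedy-hitting 0<n R m zero 𝓕 large = [] , 𝓕 , z≤n , inj₂ , (λ X∈ → X∈) , inj₂ ≤-refl
  greedy-hitting (s≤s _) R m (suc i) 𝓕 large with length 𝓕 <? m
  ... | yes 𝓕<m = [] , 𝓕 , z≤n , inj₂ , (λ X∈ → X∈) , inj₁ 𝓕<m
  ... | no  𝓕≮m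
    with v , 𝓕≤ ← pigeonhole-sum (λ v → R * length (containing v 𝓕)) (length 𝓕) (double-count R 𝓕 large)
    with H , 𝓖 , H≤i , hit , 𝓖⊆ , few ← greedy-hitting (s≤s z≤n) R m i (missing v 𝓕)
                                          (large ∘ proj₁ ∘ ∈-filter⁻ (λ X → ¬? (v ∈ˢ? X)))
    = v ∷ H , 𝓖 , s≤s H≤i , hit′ , proj₁ ∘ ∈-filter⁻ (λ X → ¬? (v ∈ˢ? X)) ∘ 𝓖⊆ , few′ few
    where
    open ≤-Reasoning
    hit′ : ∀ {X} → X ∈ 𝓕 → Hits (v ∷ H) X ⊎ X ∈ 𝓖
    hit′ {X} X∈ with v ∈ˢ? X
    ... | yes v∈X = inj₁ (v , here refl , v∈X)
    ... | no  v∉X with hit (∈-filter⁺ (λ X → ¬? (v ∈ˢ? X)) X∈ v∉X)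
    ...   | inj₁ (u , u∈H , u∈X) = inj₁ (u , there u∈H , u∈X)
    ...   | inj₂ X∈𝓖             = inj₂ X∈𝓖
    few′ : length 𝓖 < m ⊎ i * m + R * length 𝓖 ≤ R * length (missing v 𝓕) →
           length 𝓖 < m ⊎ suc i * m + R * length 𝓖 ≤ R * length 𝓕
    few′ (inj₁ 𝓖<m) = inj₁ 𝓖<m
    few′ (inj₂ le)  = inj₂ (begin
      m + i * m + R * length 𝓖                                     ≡⟨ +-assoc m _ _ ⟩
      m + (i * m + R * length 𝓖)                                   ≤⟨ +-mono-≤ (≤-trans (≮⇒≥ 𝓕≮m) 𝓕≤) le ⟩
      R * length (containing v 𝓕) + R * length (missing v 𝓕)       ≡⟨ *-distribˡ-+ R _ (length (missing v 𝓕)) ⟨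
      R * (length (containing v 𝓕) + length (missing v 𝓕))         ≡⟨ cong (R *_) (length-containing+missing v 𝓕) ⟩
      R * length 𝓕                                                 ∎)

  -- Each of the `ℓ` rounds makes `b * R` greedy picks. As long as at least `b ^ ℓ` sets are missed,
  -- a pick hits at least `b ^ ℓ / R` of them, so a family of fewer than `b ^ suc ℓ` sets must drop
  -- below `b ^ ℓ` within the round. Below `b ^ 0` no set is left.
  hitting-list : 0 < n → ∀ b R ℓ (𝓕 : List (VSet n)) → 0 < R → (∀ {X} → X ∈ 𝓕 → n ≤ R * count X) →
    length 𝓕 < b ^ ℓ → ∃[ H ] length H ≤ ℓ * (b * R) × (∀ {X} → X ∈ 𝓕 → Hits H X)
  hitting-list 0<n b R zero [] 0<R large 𝓕< = [] , z≤n , λ ()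
  hitting-list 0<n b R zero (_ ∷ _) 0<R large (s≤s ())
  hitting-list 0<n b R (suc ℓ) 𝓕 0<R large 𝓕< =
    let (H , 𝓖 , H≤ , hit , 𝓖⊆ , few) = greedy-hitting 0<n R (b ^ ℓ) (b * R) 𝓕 large
        (H′ , H′≤ , hit′) = hitting-list 0<n b R ℓ 𝓖 0<R (large ∘ 𝓖⊆) (𝓖< few)
    in H ++ H′ ,
       ≤-trans (≤-reflexive (length-++ H)) (+-mono-≤ H≤ H′≤) ,
       λ X∈ → [ (λ { (v , v∈ , v∈X) → v , ∈-++⁺ˡ v∈ , v∈X }) ,
                (λ X∈𝓖 → let (v , v∈ , v∈X) = hit′ X∈𝓖 in v , ∈-++⁺ʳ H v∈ , v∈X) ]′ (hit X∈)
    where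
    open ≤-Reasoning
    swap : ∀ x y z → x * (y * z) ≡ y * x * z
    swap = solve-∀
    𝓖< : ∀ {g} → g < b ^ ℓ ⊎ b * R * b ^ ℓ + R * g ≤ R * length 𝓕 → g < b ^ ℓ
    𝓖< (inj₁ g<) = g<
    𝓖< {g} (inj₂ le) = ⊥-elim (<-irrefl refl (begin-strict
      R * length 𝓕              <⟨ *-monoʳ-< R {{>-nonZero 0<R}} 𝓕< ⟩
      R * (b * b ^ ℓ)           ≡⟨ swap R b (b ^ ℓ) ⟩
      b * R * b ^ ℓ             ≤⟨ m≤m+n _ (R * g) ⟩
      b * R * b ^ ℓ + R * g     ≤⟨ le ⟩
      R * length 𝓕              ∎))

  lists≤ : ℕ → List (List (Fin n))
  lists≤ zero    = [] ∷ []
  lists≤ (suc s) = [] ∷ cartesianProductWith _∷_ (allFin n) (lists≤ s)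

  ∈-lists≤ : ∀ s A → length A ≤ s → A ∈ lists≤ s
  ∈-lists≤ zero    []      _         = here refl
  ∈-lists≤ (suc s) []      _         = here refl
  ∈-lists≤ (suc s) (a ∷ A) (s≤s A≤s) = there (∈-cartesianProductWith⁺ _∷_ (∈-allFin a) (∈-lists≤ s A A≤s))

  length-lists≤ : ∀ s → length (lists≤ s) ≤ suc n ^ s
  length-lists≤ zero    = ≤-refl
  length-lists≤ (suc s) = begin
    suc (length (cartesianProductWith _∷_ (allFin n) (lists≤ s)))
      ≡⟨ cong suc (length-cartesianProductWith _∷_ (allFin n) (lists≤ s)) ⟩
    suc (length (allFin n) * length (lists≤ s))
      ≡⟨ cong (λ k → suc (k * length (lists≤ s))) (length-tabulate {n = n} (λ i → i)) ⟩
    1 + n * length (lists≤ s)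
      ≤⟨ +-mono-≤ (m^n>0 (suc n) s) (*-monoʳ-≤ n (length-lists≤ s)) ⟩
    suc n ^ s + n * suc n ^ s                                      ∎
    where open ≤-Reasoning

  -- If few of H met Y T, those few would form a list Z with Y T ∖ Z unhit.
  scale : 0 < n → ∀ (Y : List (Fin n) → VSet n) b s g R ℓ → 0 < R → n ≤ R * g → suc n ^ (s + b * s) < b ^ ℓ →
    ∃[ H ] length H ≤ ℓ * (b * R) ×
      (∀ T → length T ≤ s → length (members (Y T) H) ≤ b * s → count (Y T) < b * s + g)
  scale 0<n Y b s g R ℓ 0<R n≤Rg family< = H , H≤ , small
    where
    open ≤-Reasoning
    all-sets 𝓕 : List (VSet n)
    -- `Z` has to range over all short lists, since the hits of `H` in `Y T` are known only after
    -- `H` has been built.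
    all-sets = cartesianProductWith (λ T Z → Y T ∖ ⟦ Z ⟧) (lists≤ s) (lists≤ (b * s))
    big? = λ X → n ≤? R * count X
    𝓕 = filter big? all-sets
    𝓕< : length 𝓕 < b ^ ℓ
    𝓕< = begin-strict
      length 𝓕                                       ≤⟨ length-filter big? all-sets ⟩
      length all-sets                                ≡⟨ length-cartesianProductWith _ (lists≤ s) (lists≤ (b * s)) ⟩
      length (lists≤ s) * length (lists≤ (b * s))    ≤⟨ *-mono-≤ (length-lists≤ s) (length-lists≤ (b * s)) ⟩
      suc n ^ s * suc n ^ (b * s)                    ≡⟨ ^-distribˡ-+-* (suc n) s (b * s) ⟨
      suc n ^ (s + b * s)                            <⟨ family< ⟩
      b ^ ℓ                                          ∎
    hitting = hitting-list 0<n b R ℓ 𝓕 0<R (λ X∈ → proj₂ (∈-filter⁻ big? {xs = all-sets} X∈)) 𝓕<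
    H = proj₁ hitting
    H≤ = proj₁ (proj₂ hitting)
    small : ∀ T → length T ≤ s → length (members (Y T) H) ≤ b * s → count (Y T) < b * s + g
    small T T≤s Z≤ = ≰⇒> λ large →
      let Z = members (Y T) H
          X = Y T ∖ ⟦ Z ⟧
          g≤X : g ≤ count X
          g≤X = +-cancelˡ-≤ (b * s) _ _ (begin
            b * s + g                                ≤⟨ large ⟩
            count (Y T)                              ≡⟨ count-split (Y T) ⟦ Z ⟧ ⟩
            count (Y T ∩ ⟦ Z ⟧) + count X            ≤⟨ +-monoˡ-≤ (count X) (count-mono (proj₂ ∘ ∩⁻ (Y T) ⟦ Z ⟧)) ⟩
            count ⟦ Z ⟧ + count X                    ≤⟨ +-monoˡ-≤ (count X) (≤-trans (count-⟦⟧ Z) Z≤) ⟩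
            b * s + count X                          ∎)
          X∈𝓕 = ∈-filter⁺ big? (∈-cartesianProductWith⁺ (λ T Z → Y T ∖ ⟦ Z ⟧) (∈-lists≤ s T T≤s) (∈-lists≤ (b * s) Z Z≤))
                  (≤-trans n≤Rg (*-monoʳ-≤ R g≤X))
          (v , v∈H , v∈X) = proj₂ (proj₂ hitting) X∈𝓕
          (v∈Y , v∉Z) = ∖⁻ (Y T) ⟦ Z ⟧ v∈X
      in absurd-∉ (⟦⟧⁺ Z (∈-filter⁺ (_∈ˢ? Y T) v∈H v∈Y)) v∉Z

-- Expansion at all scales at once

t<b^t : ∀ {b} → 2 ≤ b → ∀ t → t < b ^ t
t<b^t 2≤b zero    = s≤s z≤n
t<b^t {b} 2≤b (suc t) = begin-strict
  suc t              ≤⟨ t<b^t 2≤b t ⟩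
  b ^ t              <⟨ m<m+n (b ^ t) (≤-<-trans z≤n (t<b^t 2≤b t)) ⟩
  b ^ t + b ^ t      ≡⟨ cong (b ^ t +_) (+-identityʳ (b ^ t)) ⟨
  2 * b ^ t          ≤⟨ *-monoˡ-≤ (b ^ t) 2≤b ⟩
  b * b ^ t          ∎
  where open ≤-Reasoning

-- Rounding up to a power of `b` loses at most a factor `b`, so the scales `b ^ j` can stand for all
-- sizes.
power-bracket : ∀ {b t} → 0 < b → 0 < t → ∀ j → t ≤ b ^ j → ∃[ i ] t ≤ b ^ i × b ^ i ≤ b * t
power-bracket 0<b 0<t zero    t≤ = 0 , t≤ , *-mono-≤ 0<b 0<t
power-bracket {b} {t} 0<b 0<t (suc j) t≤ with t ≤? b ^ j
... | yes t≤bʲ = power-bracket 0<b 0<t j t≤bʲ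
... | no  t≰bʲ = suc j , t≤ , *-monoʳ-≤ b (<⇒≤ (≰⇒> t≰bʲ))

module _ {n : ℕ} (0<n : 0 < n) {b p G : ℕ} (2≤b : 2 ≤ b) (1≤p : 1 ≤ p)
         (n<b^ : n < b ^ (p + G)) (K≤b : 2 + (p + G) ≤ b) where

  open ≤-Reasoning

  private
    K = p + G
    instance
      b≢0 : NonZero b
      b≢0 = >-nonZero (<-≤-trans (s≤s z≤n) 2≤b)

  members-++-≤ : ∀ (X : VSet n) A B → length (members X A) ≤ length (members X (A ++ B)) ×
                                      length (members X B) ≤ length (members X (A ++ B))
  members-++-≤ X A B rewrite filter-++ (_∈ˢ? X) A B | length-++ (members X A) {members X B} =
    m≤m+n _ _ , m≤n+m _ _

  exponents : ∀ j i → b ^ (p + (j + i)) ≡ b ^ i * (b ^ p * b ^ j)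
  exponents j i = trans (trans (^-distribˡ-+-* b p (j + i)) (cong (b ^ p *_) (^-distribˡ-+-* b j i)))
                      (rearrange (b ^ p) (b ^ j) (b ^ i))
    where
    rearrange : ∀ x y z → x * (y * z) ≡ z * (x * y)
    rearrange = solve-∀

  -- The number of rounds grows like `b ^ j` and the reciprocal density is `b ^ i`, so the scale
  -- cancels in the product. The remaining factors are absorbed by `b ^ 3` because `2 + K ≤ b`.
  size : ∀ j i → j + i ≡ G → (1 + K * (b ^ j + b * b ^ j)) * (b * b ^ i) ≤ b ^ (3 + G)
  size j i j+i≡G = begin
    (1 + K * (b ^ j + b * b ^ j)) * (b * b ^ i)         ≤⟨ *-monoˡ-≤ (b * b ^ i) (+-monoˡ-≤ _ (m^n>0 b j)) ⟩
    (b ^ j + K * (b ^ j + b * b ^ j)) * (b * b ^ i)     ≡⟨ factor K b (b ^ j) (b ^ i) ⟩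
    (1 + K + K * b) * b * (b ^ j * b ^ i)               ≡⟨ cong ((1 + K + K * b) * b *_) (^-distribˡ-+-* b j i) ⟨
    (1 + K + K * b) * b * b ^ (j + i)                   ≡⟨ cong (λ k → (1 + K + K * b) * b * b ^ k) j+i≡G ⟩
    (1 + K + K * b) * b * b ^ G                         ≤⟨ *-monoˡ-≤ (b ^ G) (*-monoˡ-≤ b (+-monoˡ-≤ (K * b) 1+K≤b)) ⟩
    (b + K * b) * b * b ^ G                             ≤⟨ *-monoˡ-≤ (b ^ G) (*-monoˡ-≤ b (*-monoˡ-≤ b 1+K≤b)) ⟩
    b * b * b * b ^ G                                   ≡⟨ assoc b (b ^ G) ⟩
    b ^ (3 + G)                                         ∎
    where
    1+K≤b : 1 + K ≤ b
    1+K≤b = ≤-trans (n≤1+n _) K≤b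
    factor : ∀ K b x y → (x + K * (x + b * x)) * (b * y) ≡ (1 + K + K * b) * b * (x * y)
    factor = solve-∀
    assoc : ∀ b x → b * b * b * x ≡ b * (b * (b * x))
    assoc = solve-∀

  scales : ∀ (Y : List (Fin n) → VSet n) m → m ≤ suc G → ∃[ H ] length H ≤ m * b ^ (3 + G) ×
    (∀ j → j < m → ∀ T → length T ≤ b ^ j → length (members (Y T) H) ≤ b * b ^ j →
       count (Y T) < b * b ^ j + b ^ p * b ^ j)
  scales Y zero    m≤ = [] , z≤n , λ j ()
  scales Y (suc j) (s≤s j≤G) =
    let (H , H≤ , small) = scales Y j (m≤n⇒m≤1+n j≤G)
        (i , j+i≡G) = m≤n⇒∃[o]m+o≡n j≤G
        n≤ = <⇒≤ (<-≤-trans n<b^ (≤-reflexive (trans (cong (λ k → b ^ (p + k)) (≡-sym j+i≡G)) (exponents j i))))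
        -- With `i = G - j`, a set of `b ^ p * b ^ j` vertices is at least a `1 / b ^ i` share of
        -- all of them, as `n < b ^ (p + G)`.
        (H′ , H′≤ , small′) = scale 0<n Y b (b ^ j) (b ^ p * b ^ j) (b ^ i) (1 + K * (b ^ j + b * b ^ j))
                                (m^n>0 b i) n≤ family<
    in H′ ++ H ,
       ≤-trans (≤-reflexive (length-++ H′)) (+-mono-≤ (≤-trans H′≤ (size j i j+i≡G)) H≤) ,
       combine H H′ small small′
    where
    family< : suc n ^ (b ^ j + b * b ^ j) < b ^ (1 + K * (b ^ j + b * b ^ j))
    family< = begin-strict
      suc n ^ (b ^ j + b * b ^ j)        ≤⟨ ^-monoˡ-≤ (b ^ j + b * b ^ j) n<b^ ⟩
      (b ^ K) ^ (b ^ j + b * b ^ j)      ≡⟨ ^-*-assoc b K _ ⟩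
      b ^ (K * (b ^ j + b * b ^ j))      <⟨ ^-monoʳ-< b 2≤b (n<1+n (K * (b ^ j + b * b ^ j))) ⟩
      b ^ (1 + K * (b ^ j + b * b ^ j))  ∎
    Small : ℕ → List (Fin n) → Set
    Small k H = ∀ T → length T ≤ b ^ k → length (members (Y T) H) ≤ b * b ^ k →
                count (Y T) < b * b ^ k + b ^ p * b ^ k
    combine : ∀ H H′ → (∀ k → k < j → Small k H) → Small j H′ → ∀ k → k < suc j → Small k (H′ ++ H)
    combine H H′ small small′ k k<1+j T T≤ hits≤ with m<1+n⇒m<n∨m≡n k<1+j
    ... | inj₁ k<j  = small k k<j T T≤ (≤-trans (proj₂ (members-++-≤ (Y T) H′ H)) hits≤)
    ... | inj₂ refl = small′ T T≤ (≤-trans (proj₁ (members-++-≤ (Y T) H′ H)) hits≤)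

  -- Of the two extra factors `b` in `b ^ (2 + p)`, one pays for rounding `length T` to a power of
  -- `b` and one for the sum of the two terms that `scale` leaves.
  Expanding : (List (Fin n) → VSet n) → List (Fin n) → Set
  Expanding Y C = ∀ T → length (members (Y T) C) ≤ b * length T → count (Y T) ≤ b ^ (2 + p) * length T

  expanding-list : ∀ Y → count (Y []) ≤ 0 → ∃[ C ] length C ≤ b ^ (4 + G) × Expanding Y C
  expanding-list Y Y[] =
    let (H , H≤ , small) = scales Y (suc G) ≤-refl
    in H , ≤-trans H≤ (*-monoˡ-≤ (b ^ (3 + G)) (≤-trans (s≤s (m≤n+m G p)) (≤-trans (n≤1+n _) K≤b))) ,
       expanding H small
    where
    rearrange : ∀ b x t → b * (x * (b * t)) ≡ b * (b * x) * t
    rearrange = solve-∀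
    expanding : ∀ H → (∀ j → j < suc G → ∀ T → length T ≤ b ^ j → length (members (Y T) H) ≤ b * b ^ j →
                  count (Y T) < b * b ^ j + b ^ p * b ^ j) → Expanding Y H
    expanding H small []         _     = ≤-trans Y[] z≤n
    expanding H small T@(_ ∷ T′) hits≤ =
      let (j , T≤ , ≤bT) = power-bracket (≤-trans (s≤s z≤n) 2≤b) (s≤s z≤n) (length T) (<⇒≤ (t<b^t 2≤b (length T)))
      in bound j T≤ ≤bT (j ≤? G)
      where
      b≤b^p : b ≤ b ^ p
      b≤b^p = ≤-trans (≤-reflexive (≡-sym (^-identityʳ b))) (^-monoʳ-≤ b 1≤p)
      bound : ∀ j → length T ≤ b ^ j → b ^ j ≤ b * length T → Dec (j ≤ G) →
              count (Y T) ≤ b ^ (2 + p) * length T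
      bound j T≤ ≤bT (yes j≤G) = begin
        count (Y T)                        ≤⟨ <⇒≤ (small j (s≤s j≤G) T T≤ (≤-trans hits≤ (*-monoʳ-≤ b T≤))) ⟩
        b * b ^ j + b ^ p * b ^ j          ≤⟨ +-monoˡ-≤ (b ^ p * b ^ j) (*-monoˡ-≤ (b ^ j) b≤b^p) ⟩
        b ^ p * b ^ j + b ^ p * b ^ j      ≡⟨ cong (b ^ p * b ^ j +_) (+-identityʳ _) ⟨
        2 * (b ^ p * b ^ j)                ≤⟨ *-mono-≤ 2≤b (*-monoʳ-≤ (b ^ p) ≤bT) ⟩
        b * (b ^ p * (b * length T))       ≡⟨ rearrange b (b ^ p) (length T) ⟩
        b ^ (2 + p) * length T             ∎
      -- Beyond the largest scale `b ^ G` the bound is trivial: it exceeds `n`.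
      bound j T≤ ≤bT (no j≰G) = begin
        count (Y T)                        ≤⟨ count≤n (Y T) ⟩
        n                                  ≤⟨ <⇒≤ n<b^ ⟩
        b ^ (p + G)                        ≡⟨ ^-distribˡ-+-* b p G ⟩
        b ^ p * b ^ G                      ≤⟨ *-monoʳ-≤ (b ^ p) (^-monoʳ-≤ b (<⇒≤ (≰⇒> j≰G))) ⟩
        b ^ p * b ^ j                      ≤⟨ *-monoʳ-≤ (b ^ p) ≤bT ⟩
        b ^ p * (b * length T)             ≤⟨ m≤n*m _ b ⟩
        b * (b ^ p * (b * length T))       ≡⟨ rearrange b (b ^ p) (length T) ⟩
        b ^ (2 + p) * length T             ∎

  -- Additional cops only raise the number of hits, so the premise of `Expanding` becomes stronger.
  Expanding-++ : ∀ Y A B → Expanding Y A ⊎ Expanding Y B → Expanding Y (A ++ B)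
  Expanding-++ Y A B (inj₁ expA) T hits≤ = expA T (≤-trans (proj₁ (members-++-≤ (Y T) A B)) hits≤)
  Expanding-++ Y A B (inj₂ expB) T hits≤ = expB T (≤-trans (proj₂ (members-++-≤ (Y T) A B)) hits≤)

  -- The same team has to expand for the balls of radius 2 and of radius 3. Padding with an
  -- arbitrary vertex makes its size exact.
  expanding-pair : ∀ Y₁ Y₂ → count (Y₁ []) ≤ 0 → count (Y₂ []) ≤ 0 →
    ∃[ C ] length C ≡ b ^ (5 + G) × Expanding Y₁ C × Expanding Y₂ C
  expanding-pair Y₁ Y₂ Y₁[] Y₂[] =
    let (C₁ , C₁≤ , exp₁) = expanding-list Y₁ Y₁[]
        (C₂ , C₂≤ , exp₂) = expanding-list Y₂ Y₂[]
        C₁₂≤ = C₁₂-bound C₁ C₂ C₁≤ C₂≤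
    in C₁ ++ C₂ ++ padding C₁ C₂ , length-C C₁ C₂ C₁₂≤ ,
       Expanding-++ Y₁ C₁ _ (inj₁ exp₁) ,
       Expanding-++ Y₂ C₁ _ (inj₂ (Expanding-++ Y₂ C₂ _ (inj₁ exp₂)))
    where
    C₁₂-bound : ∀ (C₁ C₂ : List (Fin n)) → length C₁ ≤ b ^ (4 + G) → length C₂ ≤ b ^ (4 + G) →
                length C₁ + length C₂ ≤ b ^ (5 + G)
    C₁₂-bound C₁ C₂ C₁≤ C₂≤ = begin
      length C₁ + length C₂              ≤⟨ +-mono-≤ C₁≤ C₂≤ ⟩
      b ^ (4 + G) + b ^ (4 + G)          ≡⟨ cong (b ^ (4 + G) +_) (+-identityʳ _) ⟨
      2 * b ^ (4 + G)                    ≤⟨ *-monoˡ-≤ (b ^ (4 + G)) 2≤b ⟩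
      b ^ (5 + G)                        ∎
    deficit : (C₁ C₂ : List (Fin n)) → ℕ
    deficit C₁ C₂ = b ^ (5 + G) ∸ (length C₁ + length C₂)
    padding : (C₁ C₂ : List (Fin n)) → List (Fin n)
    padding C₁ C₂ = replicate (deficit C₁ C₂) (fromℕ< 0<n)
    length-C : ∀ C₁ C₂ → length C₁ + length C₂ ≤ b ^ (5 + G) →
               length (C₁ ++ C₂ ++ padding C₁ C₂) ≡ b ^ (5 + G)
    length-C C₁ C₂ C₁₂≤ = begin-equality
      length (C₁ ++ C₂ ++ padding C₁ C₂)                       ≡⟨ length-++ C₁ ⟩
      length C₁ + length (C₂ ++ padding C₁ C₂)                 ≡⟨ cong (length C₁ +_) (length-++ C₂) ⟩
      length C₁ + (length C₂ + length (padding C₁ C₂))         ≡⟨ +-assoc (length C₁) _ _ ⟨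
      length C₁ + length C₂ + length (padding C₁ C₂)           ≡⟨ cong (length C₁ + length C₂ +_) (length-replicate _) ⟩
      length C₁ + length C₂ + deficit C₁ C₂                    ≡⟨ m+[n∸m]≡n C₁₂≤ ⟩
      b ^ (5 + G)                                              ∎

-- Teams of cops and the robber trajectories they catch

-- A set of continuations of the robber's walk; the current vertex is not part of the vector.
Event : ℕ → ℕ → Set₁
Event n T = Vec (Fin n) T → Set

module Pursuit {n : ℕ} (_~_ : Fin n → Fin n → Set) (_~?_ : ∀ u v → Dec (u ~ v))
               (~-refl : ∀ {v} → v ~ v) (~-sym : ∀ {u v} → u ~ v → v ~ u) where

  V : Set
  V = Fin n

  abstract
    nb : V → VSet n
    nb v u = does (v ~? u)

    nb⁺ : ∀ {v u} → v ~ u → u ∈ˢ nb v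
    nb⁺ {v} {u} v~u = is-in (dec-true (v ~? u) v~u)

    nb⁻ : ∀ v {u} → u ∈ˢ nb v → v ~ u
    nb⁻ v {u} (is-in u∈) = does⁻ (v ~? u) u∈

    N : VSet n → VSet n
    N X v = does (any? λ u → (u ∈ˢ? X) ×-dec (u ~? v))

    N⁺ : ∀ X {u v} → u ∈ˢ X → u ~ v → v ∈ˢ N X
    N⁺ X {u} u∈X u~v = is-in (dec-true (any? _) (u , u∈X , u~v))

    N⁻ : ∀ X {v} → v ∈ˢ N X → ∃[ u ] u ∈ˢ X × u ~ v
    N⁻ X (is-in v∈) = does⁻ (any? _) v∈

  N-mono : ∀ X Y → X ⊆ˢ Y → N X ⊆ˢ N Y
  N-mono X Y X⊆Y v∈ = let (u , u∈X , u~v) = N⁻ X v∈ in N⁺ Y (X⊆Y u∈X) u~v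

  N^ : ℕ → VSet n → VSet n
  N^ zero    X = X
  N^ (suc k) X = N (N^ k X)

  N^-mono : ∀ k X Y → X ⊆ˢ Y → N^ k X ⊆ˢ N^ k Y
  N^-mono zero    X Y X⊆Y = X⊆Y
  N^-mono (suc k) X Y X⊆Y = N-mono (N^ k X) (N^ k Y) (N^-mono k X Y X⊆Y)

  data Walk : ℕ → V → V → Set where
    done : ∀ {v} → Walk 0 v v
    move : ∀ {k u w v} → u ~ w → Walk k w v → Walk (suc k) u v

  stay : ∀ k {v} → Walk k v v
  stay zero    = done
  stay (suc k) = move ~-refl (stay k)

  Walk-unsnoc : ∀ {k u v} → Walk (suc k) u v → ∃[ w ] Walk k u w × w ~ v
  Walk-unsnoc (move u~v done) = _ , done , u~v
  Walk-unsnoc (move u~w p@(move _ _)) = let (x , q , x~v) = Walk-unsnoc p in x , move u~w q , x~v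

  N^-walk : ∀ k A {v} → v ∈ˢ N^ k ⟦ A ⟧ → ∃[ a ] a ∈ A × Walk k v a
  N^-walk zero    A v∈ = _ , ⟦⟧⁻ A v∈ , done
  N^-walk (suc k) A v∈ =
    let (u , u∈ , u~v) = N⁻ (N^ k ⟦ A ⟧) v∈
        (a , a∈A , p)  = N^-walk k A u∈
    in a , a∈A , move (~-sym u~v) p

  count-N^-[] : ∀ k → count (N^ k ⟦ [] ⟧) ≤ 0
  count-N^-[] k = count-empty (N^ k ⟦ [] ⟧) λ v∈ → case N^-walk k [] v∈ of λ ()

  Near : List V → V → Set
  Near c v = Any (_~ v) c

  IsPath : ∀ {T} → V → Vec V T → Set
  IsPath v []      = ⊤
  IsPath v (w ∷ p) = v ~ w × IsPath w p

  -- H records whether a capture was possible at an earlier time, so that events are tested only at the end.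
  Catch : ∀ T → Set → List V → V → Event n T → Set
  Catch zero    H c v E = E [] → H ⊎ Near c v
  Catch (suc T) H c v E = ∃[ c′ ] Pointwise _~_ c c′ ×
                            (∀ w → v ~ w → Catch T (H ⊎ Near c v) c′ w (E ∘ (w ∷_)))

  Catch-mono : ∀ {T H H′ c v} {E E′ : Event n T} → (H → H′) → (∀ p → IsPath v p → E′ p → E p) →
               Catch T H c v E → Catch T H′ c v E′
  Catch-mono {zero} H⇒ E⇐ catch e = [ inj₁ ∘ H⇒ , inj₂ ]′ (catch (E⇐ [] tt e))
  Catch-mono {suc T} {H} {H′} {c} {v} H⇒ E⇐ (c′ , c~c′ , next) =
    c′ , c~c′ , λ w v~w → Catch-mono H⇒′ (λ p path → E⇐ (w ∷ p) (v~w , path)) (next w v~w)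
    where
    H⇒′ : H ⊎ Near c v → H′ ⊎ Near c v
    H⇒′ = [ inj₁ ∘ H⇒ , inj₂ ]′

  -- The two groups of cops play side by side, each ignoring the other. This is why numbers of teams
  -- add up.
  Catch-∪ : ∀ {T H₁ H₂ H c₁ c₂ v} {E₁ E₂ : Event n T} → (H₁ → H) → (H₂ → H) →
            Catch T H₁ c₁ v E₁ → Catch T H₂ c₂ v E₂ → Catch T H (c₁ ++ c₂) v (λ p → E₁ p ⊎ E₂ p)
  Catch-∪ {zero} {c₁ = c₁} H₁⇒ H₂⇒ catch₁ catch₂ (inj₁ e) = [ inj₁ ∘ H₁⇒ , inj₂ ∘ Any.++⁺ˡ ]′ (catch₁ e)
  Catch-∪ {zero} {c₁ = c₁} H₁⇒ H₂⇒ catch₁ catch₂ (inj₂ e) = [ inj₁ ∘ H₂⇒ , inj₂ ∘ Any.++⁺ʳ c₁ ]′ (catch₂ e)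
  Catch-∪ {suc T} {H₁} {H₂} {H} {c₁} {c₂} {v} H₁⇒ H₂⇒ (c₁′ , c₁~ , next₁) (c₂′ , c₂~ , next₂) =
    c₁′ ++ c₂′ , Pointwise-++⁺ c₁~ c₂~ , λ w v~w →
      Catch-∪ [ inj₁ ∘ H₁⇒ , inj₂ ∘ Any.++⁺ˡ ]′ [ inj₁ ∘ H₂⇒ , inj₂ ∘ Any.++⁺ʳ c₁ ]′ (next₁ w v~w) (next₂ w v~w)

  all-stay : ∀ c → Pointwise _~_ c c
  all-stay c = Pointwise-refl ~-refl

  Catch-idle : ∀ T {H c v} {E : Event n T} → (∀ p → IsPath v p → E p → H) → Catch T H c v E
  Catch-idle zero    E⇒H e = inj₁ (E⇒H [] tt e)
  Catch-idle (suc T) {c = c} E⇒H =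
    c , all-stay c , λ w v~w → Catch-idle T λ p path e → inj₁ (E⇒H (w ∷ p) (v~w , path) e)

  -- By waiting one move the cops see `w` first, so their strategy may depend on it.
  Catch-delay : ∀ {T H c v} {E : Event n (suc T)} → (∀ w → v ~ w → Catch T H c w (E ∘ (w ∷_))) →
                Catch (suc T) H c v E
  Catch-delay {c = c} catch = c , all-stay c , λ w v~w → Catch-mono inj₁ (λ p _ e → e) (catch w v~w)

  prefix : ∀ T {T′} → Vec V (T + T′) → Vec V T
  prefix zero    _       = []
  prefix (suc T) (w ∷ p) = w ∷ prefix T p

  Catch-extend : ∀ T {T′ H c v} {E : Event n T} → Catch T H c v E → Catch (T + T′) H c v (E ∘ prefix T)
  Catch-extend zero {zero} catch e = catch e
  Catch-extend zero {suc T′} {c = c} catch =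
    -- From here on the chance of capture is part of the history, so the cops need not move any
    -- more.
    c , all-stay c , λ w v~w → Catch-idle T′ λ p path e → catch e
  Catch-extend (suc T) (c′ , c~c′ , next) = c′ , c~c′ , λ w v~w → Catch-extend T (next w v~w)

  last : ∀ {T} → V → Vec V T → V
  last v []      = v
  last v (w ∷ p) = last w p

  Catch-goto : ∀ T {H c d v} → Pointwise (Walk T) c d → Catch T H c v (λ p → Near d (last v p))
  Catch-goto zero {c = c} {d} {v} walks near = inj₂ (subst (λ c → Near c v) (≡-sym (arrived walks)) near)
    where
    arrived : ∀ {c d} → Pointwise (Walk 0) c d → c ≡ d
    arrived []            = refl
    arrived (done ∷ walks) = cong (_ ∷_) (arrived walks)
  Catch-goto (suc T) walks =
    let (c′ , c~c′ , walks′) = first walks in c′ , c~c′ , λ w v~w → Catch-goto T walks′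
    where
    first : ∀ {c d} → Pointwise (Walk (suc T)) c d → ∃[ c′ ] Pointwise _~_ c c′ × Pointwise (Walk T) c′ d
    first [] = [] , [] , []
    first (move u~w walk ∷ walks) =
      let (c′ , c~c′ , walks′) = first walks in _ ∷ c′ , u~w ∷ c~c′ , walk ∷ walks′

  -- U is what a greedy matching of cops to the vertices of A within r + 1 moves leaves over.
  match : ∀ r C A → ∃[ d ] ∃[ U ] Pointwise (Walk r) C d × (∀ {a} → a ∈ A → Near d a ⊎ a ∈ U) ×
    (∀ {a} → a ∈ U → a ∈ A) × length (members (N^ (suc r) ⟦ U ⟧) C) + length U ≤ length A
  match r [] A = [] , A , [] , inj₂ , (λ a∈ → a∈) , ≤-refl
  match r (c ∷ C) A with c ∈ˢ? N^ (suc r) ⟦ A ⟧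
  ... | yes c∈ =
    let (a , a∈A , walk) = N^-walk (suc r) A c∈
        -- The last step of the walk is kept for the capture itself.
        (x , walk′ , x~a) = Walk-unsnoc walk
        other? = λ y → ¬? (y ≟ᶠ a)
        A′ = filter other? A
        (d , U , walks , matched , U⊆A′ , few) = match r C A′
    in x ∷ d , U , walk′ ∷ walks , matched′ a A′ x~a refl matched ,
       (λ u∈ → proj₁ (∈-filter⁻ other? (U⊆A′ u∈))) ,
       -- The cop `c` may count as a hit near `U`, but it has removed at least one vertex from `A`
       -- in exchange.
       ≤-trans (+-monoˡ-≤ (length U) (one-more (N^ (suc r) ⟦ U ⟧)))
         (≤-trans (s≤s few) (filter-notAll other? A (Any.map (λ { refl a≢a → a≢a refl }) a∈A)))
    where
    matched′ : ∀ a A′ {x d U} → x ~ a → A′ ≡ filter (λ y → ¬? (y ≟ᶠ a)) A →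
               (∀ {y} → y ∈ A′ → Near d y ⊎ y ∈ U) → ∀ {y} → y ∈ A → Near (x ∷ d) y ⊎ y ∈ U
    matched′ a A′ x~a refl matched {y} y∈A with y ≟ᶠ a
    ... | yes refl = inj₁ (here x~a)
    ... | no  y≢a  = [ inj₁ ∘ there , inj₂ ]′ (matched (∈-filter⁺ (λ y → ¬? (y ≟ᶠ a)) y∈A y≢a))
    one-more : ∀ X → length (members X (c ∷ C)) ≤ suc (length (members X C))
    one-more X with X c
    ... | true  = ≤-refl
    ... | false = n≤1+n _
  ... | no c∉ =
    let (d , U , walks , matched , U⊆A , few) = match r C A
        -- A cop that reaches nothing in `A` reaches nothing in `U`, so it is not a hit.
        c∉U = λ c∈ → c∉ (N^-mono (suc r) ⟦ U ⟧ ⟦ A ⟧ (λ u∈ → ⟦⟧⁺ A (U⊆A (⟦⟧⁻ U u∈))) c∈)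
    in c ∷ d , U , stay r ∷ walks , (λ a∈ → [ inj₁ ∘ there , inj₂ ]′ (matched a∈)) , U⊆A ,
       subst (λ k → k + length U ≤ length A)
         (cong length (≡-sym (filter-reject (_∈ˢ? N^ (suc r) ⟦ U ⟧) {xs = C} c∉U))) few

  abstract
    -- While some vertex has more than `D` neighbours in what is left of `X`, it is put into `Q` and
    -- its neighbours are removed. Each such choice uses up `suc D` elements of `X`, so there are at
    -- most `q` of them.
    dominate : ∀ q D X → count X ≤ q * suc D →
      ∃[ Q ] length Q ≤ q × (∀ u → count (nb u ∩ (X ∖ N ⟦ Q ⟧)) ≤ D)
    dominate zero D X X≤ = [] , z≤n , λ u →
      ≤-trans (count-mono (proj₁ ∘ ∖⁻ X (N ⟦ [] ⟧) ∘ proj₂ ∘ ∩⁻ (nb u) (X ∖ N ⟦ [] ⟧))) (≤-trans X≤ z≤n)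
    dominate (suc q) D X X≤ with any? (λ u → D <? count (nb u ∩ X))
    ... | no  none = [] , z≤n , λ u →
      ≤-trans (count-mono (λ v∈ → let (v∈u , v∈X) = ∩⁻ (nb u) (X ∖ N ⟦ [] ⟧) v∈
                                  in ∩⁺ (nb u) X v∈u (proj₁ (∖⁻ X (N ⟦ [] ⟧) v∈X))))
              (≮⇒≥ λ D< → none (u , D<))
    ... | yes (u , D<) = let (Q , Q≤ , small) = dominate q D X′ X′≤ in u ∷ Q , s≤s Q≤ , small′ Q small
      where
      open ≤-Reasoning
      X′ : VSet n
      X′ = X ∖ nb u
      X′≤ : count X′ ≤ q * suc D
      X′≤ = +-cancelˡ-≤ (suc D) _ _ (begin
        suc D + count X′               ≤⟨ +-monoˡ-≤ (count X′) D< ⟩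
        count (nb u ∩ X) + count X′    ≤⟨ +-monoˡ-≤ (count X′) (count-mono λ v∈ →
                                            let (v∈u , v∈X) = ∩⁻ (nb u) X v∈ in ∩⁺ X (nb u) v∈X v∈u) ⟩
        count (X ∩ nb u) + count X′    ≡⟨ count-split X (nb u) ⟨
        count X                        ≤⟨ X≤ ⟩
        suc q * suc D                  ∎)
      small′ : ∀ Q → (∀ w → count (nb w ∩ (X′ ∖ N ⟦ Q ⟧)) ≤ D) → ∀ w → count (nb w ∩ (X ∖ N ⟦ u ∷ Q ⟧)) ≤ D
      small′ Q small w = ≤-trans (count-mono sub) (small w)
        where
        sub : nb w ∩ (X ∖ N ⟦ u ∷ Q ⟧) ⊆ˢ nb w ∩ (X′ ∖ N ⟦ Q ⟧)
        sub {v} v∈ with ∩⁻ (nb w) (X ∖ N ⟦ u ∷ Q ⟧) v∈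
        ... | v∈w , v∈X∖ with ∖⁻ X (N ⟦ u ∷ Q ⟧) v∈X∖ | ∈∨∉ v (nb u) | ∈∨∉ v (N ⟦ Q ⟧)
        ... | _   , v∉ | inj₁ v∈u | _ = absurd-∉ (N⁺ ⟦ u ∷ Q ⟧ (⟦⟧⁺ (u ∷ Q) (here refl)) (nb⁻ u v∈u)) v∉
        ... | _   , v∉ | _ | inj₁ v∈N = absurd-∉ (N-mono ⟦ Q ⟧ ⟦ u ∷ Q ⟧ (⟦⟧⁺ (u ∷ Q) ∘ there ∘ ⟦⟧⁻ Q) v∈N) v∉
        ... | v∈X , _ | inj₂ v∉u | inj₂ v∉N =
          ∩⁺ (nb w) (X′ ∖ N ⟦ Q ⟧) v∈w (∖⁺ X′ (N ⟦ Q ⟧) (∖⁺ X (nb u) v∈X v∉u) v∉N)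

last-switch : ∀ (f : ℕ → Bool) K → f 0 ≡ true → f K ≡ false → ∃[ k ] k < K × f k ≡ true × f (suc k) ≡ false
last-switch f zero    f0 fK with () ← trans (≡-sym f0) fK
last-switch f (suc K) f0 fK with f K in eq
... | true  = K , ≤-refl , eq , fK
... | false = let (k , k<K , fk , fk′) = last-switch f K f0 eq in k , m≤n⇒m≤1+n k<K , fk , fk′

-- The number of teams that a set of trajectories costs

module Strategy {n : ℕ} (_~_ : Fin n → Fin n → Set) (_~?_ : ∀ u v → Dec (u ~ v))
                (~-refl : ∀ {v} → v ~ v) (~-sym : ∀ {u v} → u ~ v → v ~ u)
                (walk₄ : ∀ u v → Pursuit.Walk _~_ _~?_ ~-refl ~-sym 4 u v) where

  open Pursuit _~_ _~?_ ~-refl ~-sym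

  module Teams (C : List V) where

    home : ℕ → List V
    home zero    = []
    home (suc u) = C ++ home u

    length-home : ∀ u → length (home u) ≡ u * length C
    length-home zero    = refl
    length-home (suc u) = trans (length-++ C) (cong (length C +_) (length-home u))

    home-+ : ∀ u w → home (u + w) ≡ home u ++ home w
    home-+ zero    w = refl
    home-+ (suc u) w = trans (cong (C ++_) (home-+ u w)) (≡-sym (++-assoc C (home u) (home w)))

    -- `u` teams at their starting positions, with no capture chance in the past, suffice against
    -- every walk in `E`.
    record Cost (u T : ℕ) (v : V) (E : Event n T) : Set where
      constructor at-cost
      field catch : Catch T ⊥ (home u) v E

    Cost-mono : ∀ {u T v} {E E′ : Event n T} → (∀ p → IsPath v p → E′ p → E p) → Cost u T v E → Cost u T v E′
    Cost-mono {T = T} {E = E} E⇐ (at-cost catch) = at-cost (Catch-mono {T} {E = E} (λ x → x) E⇐ catch)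

    Cost-∅ : ∀ {u T v} {E : Event n T} → (∀ p → IsPath v p → ¬ E p) → Cost u T v E
    Cost-∅ {T = T} empty = at-cost (Catch-idle T empty)

    Cost-∪ : ∀ {u w T v} {E₁ E₂ : Event n T} → Cost u T v E₁ → Cost w T v E₂ →
             Cost (u + w) T v (λ p → E₁ p ⊎ E₂ p)
    Cost-∪ {u} {w} {T} {v} {E₁} {E₂} (at-cost catch₁) (at-cost catch₂) =
      at-cost (subst (λ c → Catch T ⊥ c v (λ p → E₁ p ⊎ E₂ p)) (≡-sym (home-+ u w))
        (Catch-∪ {T} {⊥} {⊥} {⊥} {E₁ = E₁} {E₂} (λ ()) (λ ()) catch₁ catch₂))

    Cost-⋃ : ∀ m {u T v} (E : ℕ → Event n T) → (∀ k → Cost u T v (E k)) →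
             Cost (m * u) T v (λ p → ∃[ k ] k < m × E k p)
    Cost-⋃ zero    E cost = Cost-∅ λ { p _ (k , () , _) }
    Cost-⋃ (suc m) E cost = Cost-mono cases (Cost-∪ (cost m) (Cost-⋃ m E cost))
      where
      cases : ∀ p → IsPath _ p → ∃[ k ] k < suc m × E k p → E m p ⊎ (∃[ k ] k < m × E k p)
      cases p _ (k , k<1+m , e) with m<1+n⇒m<n∨m≡n k<1+m
      ... | inj₁ k<m  = inj₂ (k , k<m , e)
      ... | inj₂ refl = inj₁ e

    Cost-delay : ∀ {u T v} {E : Event n (suc T)} → (∀ w → v ~ w → Cost u T w (E ∘ (w ∷_))) → Cost u (suc T) v E
    Cost-delay {T = T} {E = E} cost = at-cost (Catch-delay {T} {E = E} λ w v~w → Cost.catch (cost w v~w))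

    Cost-extend : ∀ T {T′ u v} {E : Event n T} → Cost u T v E → Cost u (T + T′) v (E ∘ prefix T)
    Cost-extend T {E = E} (at-cost catch) = at-cost (Catch-extend T {E = E} catch)

    Cost-goto : ∀ T {d v} → Pointwise (Walk T) C d → Cost 1 T v (λ p → Near d (last v p))
    Cost-goto T {d} {v} walks =
      at-cost (subst (λ c → Catch T ⊥ c v (λ p → Near d (last v p))) (≡-sym (++-identityʳ C)) (Catch-goto T walks))

    -- The diameter enters here: four moves take any cop to any vertex, so one team can occupy all
    -- of `Q`.
    Cost-dominate : ∀ Q {v} → length Q ≤ length C → Cost 1 4 v (λ p → last v p ∈ˢ N ⟦ Q ⟧)
    Cost-dominate Q Q≤ =
      let (d , walks , Q⊆d) = assign C Q Q≤
      in Cost-mono (λ p _ v∈ → near Q d Q⊆d v∈) (Cost-goto 4 walks)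
      where
      assign : ∀ c Q → length Q ≤ length c → ∃[ d ] Pointwise (Walk 4) c d × (∀ {x} → x ∈ Q → x ∈ d)
      assign []      []      _        = [] , [] , λ ()
      assign (c ∷ C) []      _        = let (d , walks , _) = assign C [] z≤n in c ∷ d , stay 4 ∷ walks , λ ()
      assign (c ∷ C) (q ∷ Q) (s≤s Q≤) =
        let (d , walks , Q⊆d) = assign C Q Q≤
        in q ∷ d , walk₄ c q ∷ walks , λ { (here refl) → here refl ; (there x∈) → there (Q⊆d x∈) }
      near : ∀ Q d → (∀ {x} → x ∈ Q → x ∈ d) → ∀ {v} → v ∈ˢ N ⟦ Q ⟧ → Near d v
      near Q d Q⊆d v∈ = let (u , u∈Q , u~v) = N⁻ ⟦ Q ⟧ v∈
                        in Any.map (λ { refl → u~v }) (Q⊆d (⟦⟧⁻ Q u∈Q))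

    -- Unmatched vertices are handed to a further team as long as they are a less than 1/b fraction.
    split : ∀ b r h v A → length A < b ^ h → ∃[ S ] (∀ {a} → a ∈ S → a ∈ A) × length S ≤ length A ×
      Cost h r v (λ p → last v p ∈ A × last v p ∉ S) × length (members (N^ (suc r) ⟦ S ⟧) C) ≤ b * length S
    split b r zero v []      A<       = [] , (λ a∈ → a∈) , z≤n , Cost-∅ (λ { p _ (() , _) }) ,
      (subst (_≤ b * 0) (≡-sym (none C)) z≤n)
      where
      none : ∀ C → length (members (N^ (suc r) ⟦ [] ⟧) C) ≡ 0
      none [] = refl
      none (c ∷ C) = trans (cong length (filter-reject (_∈ˢ? N^ (suc r) ⟦ [] ⟧) {xs = C}
                       λ c∈ → case N^-walk (suc r) [] c∈ of λ ())) (none C)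
    split b r zero v (_ ∷ _) (s≤s ())
    split b r (suc h) v A A< =
      let (d , U , walks , matched , U⊆A , few) = match r C A
      in cases d U walks matched U⊆A few (length A ≤? b * length U)
      where
      cases : ∀ d U → Pointwise (Walk r) C d → (∀ {a} → a ∈ A → Near d a ⊎ a ∈ U) → (∀ {a} → a ∈ U → a ∈ A) →
              length (members (N^ (suc r) ⟦ U ⟧) C) + length U ≤ length A → Dec (length A ≤ b * length U) →
              ∃[ S ] (∀ {a} → a ∈ S → a ∈ A) × length S ≤ length A ×
                Cost (suc h) r v (λ p → last v p ∈ A × last v p ∉ S) ×
                length (members (N^ (suc r) ⟦ S ⟧) C) ≤ b * length S
      -- `U` is at least a `1/b` fraction of `A`, so `few` bounds the hits near `U` by
      -- `b * length U`, which is the premise of expansion.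
      cases d U walks matched U⊆A few (yes A≤bU) =
        U , U⊆A , ≤-trans (m≤n+m _ _) few ,
        Cost-mono (λ { p _ (x∈A , x∉U) → [ inj₁ , (λ x∈U → ⊥-elim (x∉U x∈U)) ]′ (matched x∈A) })
          (Cost-∪ {E₂ = λ _ → ⊥} (Cost-goto r walks) (Cost-∅ λ _ _ ())) ,
        ≤-trans (≤-trans (m≤m+n _ _) few) A≤bU
      cases d U walks matched U⊆A few (no A≰bU) =
        -- Here `U` has fewer than `b ^ h` elements, so `h` further teams are enough.
        let (S , S⊆U , S≤U , cost , hits≤) = split b r h v U
              (*-cancelˡ-< b (length U) (b ^ h) (<-trans (≰⇒> A≰bU) A<))
        in S , U⊆A ∘ S⊆U , ≤-trans S≤U (≤-trans (m≤n+m _ _) few) ,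
           Cost-mono (λ { p _ (x∈A , x∉S) → [ inj₁ , (λ x∈U → inj₂ (x∈U , x∉S)) ]′ (matched x∈A) })
             (Cost-∪ (Cost-goto r walks) cost) ,
           hits≤

    -- The descent on the product of the numbers of choices

    module Descent {b P K : ℕ} (n<b^K : n < b ^ K) (0<b : 0 < b) .{{_ : NonZero (length C)}}
      (P³b²≤q² : P * P * P * b * b ≤ length C * length C)
      (expanding₂ : ∀ A → length (members (N^ 2 ⟦ A ⟧) C) ≤ b * length A → count (N^ 2 ⟦ A ⟧) ≤ P * length A)
      (expanding₃ : ∀ A → length (members (N^ 3 ⟦ A ⟧) C) ≤ b * length A → count (N^ 3 ⟦ A ⟧) ≤ P * length A)
      where

      open ≤-Reasoning
      q : ℕ
      q = length C

      record Split (r : ℕ) (v : V) (X : VSet n) (D : ℕ) : Set where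
        field
          S       : List V
          S⊆X     : ∀ {x} → x ∈ S → x ∈ˢ X
          length≤ : length S ≤ D
          cost    : Cost K r v (λ p → last v p ∈ˢ X × last v p ∉ S)
          count≤  : count (N^ (suc r) ⟦ S ⟧) ≤ P * D

      abstract
        split-set : ∀ r → (∀ A → length (members (N^ (suc r) ⟦ A ⟧) C) ≤ b * length A →
                             count (N^ (suc r) ⟦ A ⟧) ≤ P * length A) →
                    ∀ v X {D} → count X ≤ D → Split r v X D
        split-set r expanding v X {D} X≤D =
          let (S , S⊆ , S≤ , cost , hits≤) = split b r K v (elements X)
                (≤-<-trans (≤-trans (≤-reflexive (length-elements X)) (count≤n X)) n<b^K)
              S≤D = ≤-trans S≤ (≤-trans (≤-reflexive (length-elements X)) X≤D)
          in record
            { S       = S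
            ; S⊆X     = λ x∈ → ∈-elements⁻ {X = X} (S⊆ x∈)
            ; length≤ = S≤D
            ; cost    = Cost-mono (λ { p _ (x∈X , x∉S) → ∈-elements⁺ x∈X , x∉S }) cost
            ; count≤  = ≤-trans (expanding S hits≤) (*-monoʳ-≤ P S≤D)
            }

      -- `dominate` asks only for `q * suc D`, so `D` may be the quotient rounded down. This lets
      -- the numbers of choices reach zero.
      m≤n*[1+m/n] : ∀ m → m ≤ q * suc (m / q)
      m≤n*[1+m/n] m = begin
        m                          ≡⟨ m≡m%n+[m/n]*n m q ⟩
        m % q + m / q * q          ≤⟨ +-monoˡ-≤ _ (<⇒≤ (m%n<n m q)) ⟩
        q + m / q * q              ≡⟨ *-comm (suc (m / q)) q ⟩
        q * suc (m / q)            ∎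

      Promise : ∀ {t} → VSet n → VSet n → Event n (2 + t)
      Promise X₁ X₂ (v₁ ∷ v₂ ∷ _) = v₁ ∈ˢ X₁ × v₂ ∈ˢ X₂

      -- `D₁` bounds the choices for the next vertex. `D₂` bounds those for the one after it, from
      -- every `w`, as the next vertex is still unknown. The descent is on the exponent `j`.
      Winning : ℕ → ℕ → ℕ → Set
      Winning j u t = ∀ v X₁ X₂ D₁ D₂ → count (nb v ∩ X₁) ≤ D₁ → (∀ w → count (nb w ∩ X₂) ≤ D₂) →
                      D₁ * D₂ < b ^ j → Cost u (2 + t) v (Promise X₁ X₂)

      -- With `r` about `P * D₁ / e` the factor `e` cancels, so every threshold gives the same
      -- bound: the product is at most `D₁ * D₂ * P³ * b / q²`, a factor `b` below the old one.
      degrees-shrink : ∀ {j D₁ D₂ r e} → D₁ * D₂ < b ^ suc j → r * e ≤ P * D₁ →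
                       (r * (P * D₂) / q) * (P * (b * e) / q) < b ^ j
      degrees-shrink {j} {D₁} {D₂} {r} {e} D< re≤ =
        *-cancelˡ-< (b * (q * q)) _ _ (begin-strict
          b * (q * q) * (x * y)                          ≡⟨ rearrange₁ b q x y ⟩
          b * ((x * q) * (y * q))                        ≤⟨ *-monoʳ-≤ b (*-mono-≤ (m/n*n≤m _ q) (m/n*n≤m _ q)) ⟩
          b * ((r * (P * D₂)) * (P * (b * e)))           ≡⟨ rearrange₂ b r P D₂ e ⟩
          (r * e) * (P * P * b * b * D₂)                 ≤⟨ *-monoˡ-≤ _ re≤ ⟩
          (P * D₁) * (P * P * b * b * D₂)                ≡⟨ rearrange₃ P D₁ D₂ b ⟩
          P * P * P * b * b * (D₁ * D₂)                  ≤⟨ *-monoˡ-≤ (D₁ * D₂) P³b²≤q² ⟩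
          q * q * (D₁ * D₂)                              <⟨ *-monoʳ-< (q * q) {{m*n≢0 q q}} D< ⟩
          q * q * (b * b ^ j)                            ≡⟨ rearrange₄ q b (b ^ j) ⟩
          b * (q * q) * b ^ j                            ∎)
        where
        x = r * (P * D₂) / q
        y = P * (b * e) / q
        rearrange₁ : ∀ b q x y → b * (q * q) * (x * y) ≡ b * ((x * q) * (y * q))
        rearrange₁ = solve-∀
        rearrange₂ : ∀ b r P D₂ e → b * ((r * (P * D₂)) * (P * (b * e))) ≡ (r * e) * (P * P * b * b * D₂)
        rearrange₂ = solve-∀
        rearrange₃ : ∀ P D₁ D₂ b → (P * D₁) * (P * P * b * b * D₂) ≡ P * P * P * b * b * (D₁ * D₂)
        rearrange₃ = solve-∀
        rearrange₄ : ∀ q b z → q * q * (b * z) ≡ b * (q * q) * z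
        rearrange₄ = solve-∀

      positive : ∀ {X : VSet n} {x} → x ∈ˢ X → 0 < count X
      positive {X} {x} x∈X with elements X | ∈-elements⁺ {X = X} x∈X | length-elements X
      ... | _ ∷ _ | _ | eq = ≤-trans (s≤s z≤n) (≤-reflexive eq)

      winning-zero : ∀ {t} → Winning 0 0 t
      winning-zero v X₁ X₂ D₁ D₂ D₁≥ D₂≥ D< = Cost-∅ impossible
        where
        impossible : ∀ p → IsPath v p → Promise X₁ X₂ p → ⊥
        impossible (v₁ ∷ v₂ ∷ _) (v~v₁ , v₁~v₂ , _) (v₁∈ , v₂∈) =
          <⇒≱ D< (*-mono-≤ (≤-trans (positive (∩⁺ (nb v) X₁ (nb⁺ v~v₁) v₁∈)) D₁≥)
                           (≤-trans (positive (∩⁺ (nb v₁) X₂ (nb⁺ v₁~v₂) v₂∈)) (D₂≥ v₁)))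

      -- `K` teams guard `v₁` and `K` guard `v₂`. Each of the `K` branches takes one team dominating
      -- `v₄`, `K` guarding `v₃`, one dominating `v₅`, and `u` for the continuation from `v₃`.
      next-units : ℕ → ℕ
      next-units u = K + (K + K * (1 + (K + (1 + u))))

      module Step {j u t} (winning : Winning j u t) (v : V) (X₁ X₂ : VSet n) (D₁ D₂ : ℕ)
                  (D₁≥ : count (nb v ∩ X₁) ≤ D₁) (D₂≥ : ∀ w → count (nb w ∩ X₂) ≤ D₂)
                  (D< : D₁ * D₂ < b ^ suc j) where

        split₁ : Split 1 v (nb v ∩ X₁) D₁
        split₁ = split-set 1 expanding₂ v (nb v ∩ X₁) D₁≥
        S₁ = Split.S split₁

        split₂ : ∀ w → Split 1 w (nb w ∩ X₂) D₂
        split₂ w = split-set 1 expanding₂ w (nb w ∩ X₂) (D₂≥ w)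
        S₂ : V → List V
        S₂ w = Split.S (split₂ w)

        F : V → VSet n
        F w = N ⟦ S₂ w ⟧

        F⊆ : ∀ {w} → w ∈ S₁ → F w ⊆ˢ N^ 2 ⟦ S₁ ⟧
        F⊆ {w} w∈ = N-mono ⟦ S₂ w ⟧ (N ⟦ S₁ ⟧) λ x∈ →
          N⁺ ⟦ S₁ ⟧ (⟦⟧⁺ S₁ w∈) (nb⁻ w (proj₁ (∩⁻ (nb w) X₂ (Split.S⊆X (split₂ w) (⟦⟧⁻ (S₂ w) x∈)))))

        module Threshold (k : ℕ) where
          cover = greedy-cover F (b ^ k) S₁
          ws = proj₁ cover
          W : VSet n
          W = ⋃ F ws
          ws⊆ : ∀ {w} → w ∈ ws → w ∈ S₁
          ws⊆ = proj₁ (proj₂ cover)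
          e≤W : length ws * b ^ k ≤ count W
          e≤W = proj₁ (proj₂ (proj₂ cover))
          rest≤ : ∀ {w} → w ∈ S₁ → count (F w ∖ W) < b ^ k
          rest≤ w∈ = proj₂ (proj₂ (proj₂ cover)) w∈ (m^n>0 b {{>-nonZero 0<b}} k)
          e≤ : length ws * b ^ k ≤ P * D₁
          e≤ = begin
            length ws * b ^ k         ≤⟨ e≤W ⟩
            count W                   ≤⟨ count-mono (λ x∈ → let (w , w∈ , x∈F) = ⋃⁻ F ws x∈ in F⊆ (ws⊆ w∈) x∈F) ⟩
            count (N^ 2 ⟦ S₁ ⟧)       ≤⟨ Split.count≤ split₁ ⟩
            P * D₁                    ∎
          NW≤ : count (N W) ≤ length ws * (P * D₂)
          NW≤ = ≤-trans (count-mono N-⋃) (count-⋃ {F = N ∘ F} (P * D₂) ws λ w → Split.count≤ (split₂ w))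
            where
            N-⋃ : N W ⊆ˢ ⋃ (N ∘ F) ws
            N-⋃ x∈ = let (y , y∈W , y~x) = N⁻ W x∈
                         (w , w∈ , y∈F) = ⋃⁻ F ws y∈W
                     in ⋃⁺ (N ∘ F) w∈ (N⁺ (F w) y∈F y~x)

        open Threshold using (W)

        Branch : ℕ → Event n (5 + t)
        Branch k (v₁ ∷ v₂ ∷ v₃ ∷ _) = v₁ ∈ S₁ × v₂ ∈ S₂ v₁ × v₃ ∈ˢ W k × v₃ ∉ˢ W (suc k)

        module _ (k : ℕ) where
          open Threshold k using (ws; NW≤; e≤)
          D₄ = length ws * (P * D₂) / q
          D₅ = P * (b * b ^ k) / q
          -- `N (W k)` is determined by `v`, so a team that leaves at once occupies `Q₄` in time for
          -- `v₄`.
          domination₄ = dominate q D₄ (N (W k)) (≤-trans NW≤ (m≤n*[1+m/n] _))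
          Q₄ = proj₁ domination₄
          X₄ = N (W k) ∖ N ⟦ Q₄ ⟧

          Undominated : Event n (5 + t)
          Undominated p@(_ ∷ _ ∷ _ ∷ v₄ ∷ _) = Branch k p × v₄ ∉ˢ N ⟦ Q₄ ⟧

          module _ (w : V) (w∈S₁ : w ∈ S₁) where
            rest = F w ∖ W (suc k)
            split₃ : Split 2 w rest (b ^ suc k)
            split₃ = split-set 2 expanding₃ w rest (<⇒≤ (Threshold.rest≤ (suc k) w∈S₁))
            S₃ = Split.S split₃
            X₅≤ : count (N^ 2 ⟦ S₃ ⟧) ≤ P * b ^ suc k
            -- The guard of `v₃` controls the ball of radius 3; the ball of radius 2 lies in it
            -- because staying is a move.
            X₅≤ = ≤-trans (count-mono (λ x∈ → N⁺ (N^ 2 ⟦ S₃ ⟧) x∈ ~-refl)) (Split.count≤ split₃)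
            -- `Q₅` depends on `w`, the vertex `v₁`; the four moves from there lead to `v₅`.
            domination₅ = dominate q D₅ (N^ 2 ⟦ S₃ ⟧) (≤-trans X₅≤ (m≤n*[1+m/n] _))
            Q₅ = proj₁ domination₅
            X₅ = N^ 2 ⟦ S₃ ⟧ ∖ N ⟦ Q₅ ⟧

            Unmatched₃ Dominated₅ Remaining : Event n (4 + t)
            Unmatched₃ (_ ∷ v₃ ∷ _)         = v₃ ∈ˢ rest × v₃ ∉ S₃
            Dominated₅ (_ ∷ _ ∷ _ ∷ v₅ ∷ _) = v₅ ∈ˢ N ⟦ Q₅ ⟧
            Remaining  (_ ∷ _ ∷ p)          = Promise X₄ X₅ p

            catch₃ : Cost K (4 + t) w Unmatched₃
            catch₃ = Cost-mono (λ { (_ ∷ _ ∷ _) _ e → e }) (Cost-extend 2 (Split.cost split₃))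

            catch₅ : Cost 1 (4 + t) w Dominated₅
            catch₅ = Cost-mono (λ { (_ ∷ _ ∷ _ ∷ _ ∷ _) _ e → e })
                       (Cost-extend 4 (Cost-dominate Q₅ (proj₁ (proj₂ domination₅))))

            catch-remaining : Cost u (4 + t) w Remaining
            -- These teams wait until the robber is at `v₃`, where the sets `X₄` and `X₅` promise
            -- its next two moves.
            catch-remaining = Cost-delay λ _ _ → Cost-delay λ v₃ _ →
              winning v₃ X₄ X₅ D₄ D₅ (proj₂ (proj₂ domination₄) v₃) (proj₂ (proj₂ domination₅))
                (degrees-shrink {j} {D₁} {D₂} {length ws} {b ^ k} D< e≤)

            outcomes : ∀ p → IsPath w p → Undominated (w ∷ p) → Unmatched₃ p ⊎ (Dominated₅ p ⊎ Remaining p)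
            outcomes (v₂ ∷ v₃ ∷ v₄ ∷ v₅ ∷ _) (_ , v₂~v₃ , v₃~v₄ , v₄~v₅ , _) ((_ , v₂∈ , v₃∈W , v₃∉W) , v₄∉) =
              by (v₃ ∈? S₃) (∈∨∉ v₅ (N ⟦ Q₅ ⟧))
              where
              by : Dec (v₃ ∈ S₃) → v₅ ∈ˢ N ⟦ Q₅ ⟧ ⊎ v₅ ∉ˢ N ⟦ Q₅ ⟧ → _
              by (no v₃∉) _ =
                inj₁ (∖⁺ (F w) (W (suc k)) (N⁺ ⟦ S₂ w ⟧ (⟦⟧⁺ (S₂ w) v₂∈) v₂~v₃) v₃∉W , v₃∉)
              by (yes _)   (inj₁ v₅∈) = inj₂ (inj₁ v₅∈)
              by (yes v₃∈) (inj₂ v₅∉) = inj₂ (inj₂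
                ( ∖⁺ (N (W k)) (N ⟦ Q₄ ⟧) (N⁺ (W k) v₃∈W v₃~v₄) v₄∉
                , ∖⁺ (N^ 2 ⟦ S₃ ⟧) (N ⟦ Q₅ ⟧) (N⁺ (N ⟦ S₃ ⟧) (N⁺ ⟦ S₃ ⟧ (⟦⟧⁺ S₃ v₃∈) v₃~v₄) v₄~v₅) v₅∉ ))

            catch-after : Cost (K + (1 + u)) (4 + t) w (Undominated ∘ (w ∷_))
            catch-after = Cost-mono outcomes (Cost-∪ catch₃ (Cost-∪ catch₅ catch-remaining))

          Dominated₄ : Event n (5 + t)
          Dominated₄ (_ ∷ _ ∷ _ ∷ v₄ ∷ _) = v₄ ∈ˢ N ⟦ Q₄ ⟧

          catch-branch : Cost (1 + (K + (1 + u))) (5 + t) v (Branch k)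
          catch-branch = Cost-mono cases
            (Cost-∪ {E₁ = Dominated₄} {E₂ = Undominated}
              (Cost-mono (λ { (_ ∷ _ ∷ _ ∷ _ ∷ _) _ e → e })
                (Cost-extend 4 (Cost-dominate Q₄ (proj₁ (proj₂ domination₄)))))
              (Cost-delay λ w _ → after w (w ∈? S₁)))
            where
            after : ∀ w → Dec (w ∈ S₁) → Cost (K + (1 + u)) (4 + t) w (Undominated ∘ (w ∷_))
            after w (yes w∈) = catch-after w w∈
            after w (no  w∉) = Cost-∅ λ { (_ ∷ _ ∷ _ ∷ _) _ ((w∈ , _) , _) → w∉ w∈ }
            cases : ∀ p → IsPath v p → Branch k p → Dominated₄ p ⊎ Undominated p
            cases (_ ∷ _ ∷ _ ∷ v₄ ∷ _) _ e with ∈∨∉ v₄ (N ⟦ Q₄ ⟧)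
            ... | inj₁ v₄∈ = inj₁ v₄∈
            ... | inj₂ v₄∉ = inj₂ (e , v₄∉)

        -- `W 0` misses fewer than one element of `F v₁`, and `W K` is empty since one chosen vertex
        -- would already give it `b ^ K > n` elements. So membership of `v₃` switches off at some
        -- `k`; nestedness of the sets `W k` is not assumed.
        find-branch : ∀ {v₁ v₃} → v₁ ∈ S₁ → v₃ ∈ˢ F v₁ → ∃[ k ] k < K × v₃ ∈ˢ W k × v₃ ∉ˢ W (suc k)
        find-branch {v₁} {v₃} v₁∈ v₃∈ =
          let (k , k<K , in-k , out-k) = last-switch (λ k → W k v₃) K (_∈ˢ_.holds in-W₀) (_∉ˢ_.fails out-W_K)
          in k , k<K , is-in in-k , not-in out-k
          where
          in-W₀ : v₃ ∈ˢ W 0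
          in-W₀ with ∈∨∉ v₃ (W 0)
          ... | inj₁ v₃∈W = v₃∈W
          ... | inj₂ v₃∉W = ⊥-elim (<⇒≱ (Threshold.rest≤ 0 v₁∈) (positive (∖⁺ (F v₁) (W 0) v₃∈ v₃∉W)))
          out-W_K : v₃ ∉ˢ W K
          out-W_K with Threshold.ws K | Threshold.e≤W K
          ... | []     | _ = not-in refl
          ... | w ∷ ws | e≤W = ⊥-elim (<⇒≱ n<b^K
            (≤-trans (m≤m+n (b ^ K) (length ws * b ^ K)) (≤-trans e≤W (count≤n (⋃ F (w ∷ ws))))))

        Outside₁ Outside₂ : Event n (5 + t)
        Outside₁ (v₁ ∷ _)      = v₁ ∈ˢ nb v ∩ X₁ × v₁ ∉ S₁
        Outside₂ (v₁ ∷ v₂ ∷ _) = v₂ ∈ˢ nb v₁ ∩ X₂ × v₂ ∉ S₂ v₁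

        catch : Cost (next-units u) (5 + t) v (Promise X₁ X₂)
        catch = Cost-mono cases
          (Cost-∪ {E₁ = Outside₁}
            (Cost-mono (λ { (_ ∷ _) _ e → e }) (Cost-extend 1 (Split.cost split₁)))
            (Cost-∪ {E₁ = Outside₂}
              -- The same `K` teams serve every `w`, because they choose their targets after seeing
              -- it.
              (Cost-delay λ w _ → Cost-mono (λ { (_ ∷ _) _ e → e }) (Cost-extend 1 (Split.cost (split₂ w))))
              (Cost-⋃ K Branch catch-branch)))
          where
          cases : ∀ p → IsPath v p → Promise X₁ X₂ p →
                  Outside₁ p ⊎ (Outside₂ p ⊎ (∃[ k ] k < K × Branch k p))
          cases (v₁ ∷ v₂ ∷ v₃ ∷ _) (v~v₁ , v₁~v₂ , v₂~v₃ , _) (v₁∈ , v₂∈) with v₁ ∈? S₁ | v₂ ∈? S₂ v₁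
          ... | no  v₁∉ | _       = inj₁ (∩⁺ (nb v) X₁ (nb⁺ v~v₁) v₁∈ , v₁∉)
          ... | yes _   | no  v₂∉ = inj₂ (inj₁ (∩⁺ (nb v₁) X₂ (nb⁺ v₁~v₂) v₂∈ , v₂∉))
          ... | yes v₁∈S | yes v₂∈S =
            let (k , k<K , in-k , out-k) = find-branch v₁∈S (N⁺ ⟦ S₂ v₁ ⟧ (⟦⟧⁺ (S₂ v₁) v₂∈S) v₂~v₃)
            in inj₂ (inj₂ (k , k<K , v₁∈S , v₂∈S , in-k , out-k))

-- Back to the game, and the choice of parameters

units : ℕ → ℕ → ℕ
units K zero    = 0
units K (suc j) = K + (K + K * (1 + (K + (1 + units K j))))

-- A round of the descent leads from `v₀` to `v₃`.
horizon : ℕ → ℕ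
horizon zero    = 0
horizon (suc j) = 3 + horizon j

module Game {n : ℕ} (G : Graph n) (adj? : ∀ u v → Dec (Adj G u v)) where

  infix 4 _~_ _~?_
  _~_ : Fin n → Fin n → Set
  _~_ = StepOrStay G

  _~?_ : ∀ u v → Dec (u ~ v)
  u ~? v = (u ≟ᶠ v) ⊎-dec adj? u v

  ~-refl : ∀ {v} → v ~ v
  ~-refl = inj₁ refl

  ~-sym : ∀ {u v} → u ~ v → v ~ u
  ~-sym (inj₁ refl) = inj₁ refl
  ~-sym (inj₂ uv)   = inj₂ (Graph.sym G uv)

  open Pursuit _~_ _~?_ ~-refl ~-sym

  Reach⇒Walk : ∀ {k u v} → Reach G k u v → Walk k u v
  Reach⇒Walk {k} here        = stay k
  Reach⇒Walk (step uw reach) = move (inj₂ uw) (Reach⇒Walk reach)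

  capture : ∀ {k} (f : Cops k n) i {r} → f i ~ r → WinFrom G f r
  capture {k} f i {r} fᵢ~r = win f′ moves (inj₁ (i , f′ᵢ))
    where
    at : ∀ j → Dec (j ≡ i) → Fin n
    at j (yes _) = r
    at j (no  _) = f j
    f′ : Cops k n
    f′ j = at j (j ≟ᶠ i)
    moves : CopsMove G f f′
    moves j with j ≟ᶠ i
    ... | yes refl = fᵢ~r
    ... | no  _    = ~-refl
    f′ᵢ : f′ i ≡ r
    f′ᵢ with i ≟ᶠ i
    ... | yes _  = refl
    ... | no i≢i = ⊥-elim (i≢i refl)

  tabulate-moves : ∀ {k} (f : Fin k → Fin n) {c′} → Pointwise _~_ (tabulate f) c′ →
                   ∃[ f′ ] c′ ≡ tabulate f′ × (∀ i → f i ~ f′ i)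
  tabulate-moves {zero}  f []             = (λ ()) , refl , λ ()
  tabulate-moves {suc k} f {x ∷ _} (f₀~x ∷ rest) =
    let (f′ , c′≡ , moves) = tabulate-moves (f ∘ suc) rest
    in (λ { zero → x ; (suc i) → f′ i }) , cong (x ∷_) c′≡ , λ { zero → f₀~x ; (suc i) → moves i }

  near-capture : ∀ {k} (f : Cops k n) {r} → Near (tabulate f) r → WinFrom G f r
  near-capture f near = let (i , fᵢ~r) = Any.tabulate⁻ near in capture f i fᵢ~r

  -- A cop near the robber captures at once, so along the play the history `H` stays false, and the
  -- final test must provide a cop near the robber.
  Catch⇒WinFrom : ∀ T {H k} (f : Cops k n) r → ¬ H → Catch T H (tabulate f) r (λ _ → ⊤) → WinFrom G f r
  Catch⇒WinFrom zero f r ¬H catch = [ (λ h → ⊥-elim (¬H h)) , near-capture f ]′ (catch tt)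
  Catch⇒WinFrom (suc T) f r ¬H (c′ , c~c′ , next) with anyList? (_~? r) (tabulate f)
  ... | yes near = near-capture f near
  ... | no ¬near with f′ , refl , moves ← tabulate-moves f c~c′ =
    win f′ moves (inj₂ λ r′ r~r′ → Catch⇒WinFrom T f′ r′ [ ¬H , ¬near ]′ (next r′ r~r′))

  Catch⇒CopsWin : ∀ T c → (∀ r → Catch T ⊥ c r (λ _ → ⊤)) → CopsWin G (length c)
  Catch⇒CopsWin T c catch = lookup c , λ r →
    Catch⇒WinFrom T (lookup c) r (λ ()) (subst (λ c → Catch T ⊥ c r (λ _ → ⊤)) (≡-sym (tabulate-lookup c)) (catch r))

  cops-win : 0 < n → DiamAtMost G 4 → ∀ {b p g} → 2 ≤ b → 1 ≤ p → n < b ^ (p + g) → 2 + (p + g) ≤ b →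
             let q = b ^ (5 + g) ; P = b ^ (2 + p) in P * P * P * b * b ≤ q * q →
             CopsWin G (units (p + g) (2 * (p + g)) * q)
  cops-win 0<n diam {b} {p} {g} 2≤b 1≤p n<b^K K≤b P³b²≤q² =
    let (C , length-C , exp₂ , exp₃) = expanding-pair 0<n 2≤b 1≤p n<b^K K≤b
          (λ A → N^ 2 ⟦ A ⟧) (λ A → N^ 3 ⟦ A ⟧) (count-N^-[] 2) (count-N^-[] 3)
    in play C length-C exp₂ exp₃
    where
    open Strategy _~_ _~?_ ~-refl ~-sym (λ u v → Reach⇒Walk (diam u v))
    K = p + g
    q = b ^ (5 + g)
    0<b : 0 < b
    0<b = ≤-trans (s≤s z≤n) 2≤b
    n²< : n * n < b ^ (2 * K)
    n²< = <-≤-trans (*-mono-< n<b^K n<b^K)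
            (≤-reflexive (trans (≡-sym (^-distribˡ-+-* b K K)) (cong (λ k → b ^ (K + k)) (≡-sym (+-identityʳ K)))))
    play : ∀ C → length C ≡ q →
           (∀ A → length (members (N^ 2 ⟦ A ⟧) C) ≤ b * length A → count (N^ 2 ⟦ A ⟧) ≤ b ^ (2 + p) * length A) →
           (∀ A → length (members (N^ 3 ⟦ A ⟧) C) ≤ b * length A → count (N^ 3 ⟦ A ⟧) ≤ b ^ (2 + p) * length A) →
           CopsWin G (units K (2 * K) * q)
    play C length-C exp₂ exp₃ =
      subst (CopsWin G) (trans (length-home u) (cong (u *_) length-C))
        (Catch⇒CopsWin (2 + horizon (2 * K)) (home u) λ r → Cost.catch (everywhere r))
      where
      open Teams C
      instance
        C≢0 : NonZero (length C)
        C≢0 = >-nonZero (≤-trans (m^n>0 b {{>-nonZero 0<b}} (5 + g)) (≤-reflexive (≡-sym length-C)))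
      open Descent {b} {b ^ (2 + p)} {K} n<b^K 0<b
             (≤-trans P³b²≤q² (≤-reflexive (≡-sym (cong₂ _*_ length-C length-C)))) exp₂ exp₃
      u = units K (2 * K)
      winning : ∀ j → Winning j (units K j) (horizon j)
      winning zero    = winning-zero
      winning (suc j) v X₁ X₂ D₁ D₂ D₁≥ D₂≥ D< =
        Step.catch {j} {units K j} {horizon j} (winning j) v X₁ X₂ D₁ D₂ D₁≥ D₂≥ D<
      everywhere : ∀ r → Cost u (2 + horizon (2 * K)) r (λ _ → ⊤)
      -- The descent starts without information: both sets are full and each move has at most `n`
      -- choices, with `n * n < b ^ (2 * K)`.
      everywhere r = Cost-mono (λ { (_ ∷ _ ∷ _) _ _ → is-in refl , is-in refl })
        (winning (2 * K) r full full n n (count≤n (nb r ∩ full)) (λ w → count≤n (nb w ∩ full)) n²<)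

root : ∀ n L → 0 < L → ∃[ b ] b ^ L ≤ n × n < suc b ^ L
root n L 0<L = search n (≤-trans (≤-reflexive (≡-sym (^-identityʳ (suc n)))) (^-monoʳ-≤ (suc n) 0<L))
  where
  search : ∀ x → n < suc x ^ L → ∃[ b ] b ^ L ≤ n × n < suc b ^ L
  search zero    n< = 0 , ≤-trans (≤-reflexive (0^L L 0<L)) z≤n , n<
    where
    0^L : ∀ L → 0 < L → 0 ^ L ≡ 0
    0^L (suc _) _ = refl
  search (suc x) n< with suc x ^ L ≤? n
  ... | yes ≤n = suc x , ≤n , n<
  ... | no  ≰n = search x (≰⇒> ≰n)

^-*-distribʳ : ∀ x y L → (x * y) ^ L ≡ x ^ L * y ^ L
^-*-distribʳ x y zero    = refl
^-*-distribʳ x y (suc L) = trans (cong (x * y *_) (^-*-distribʳ x y L)) (rearrange x y (x ^ L) (y ^ L))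
  where
  rearrange : ∀ x y z w → x * y * (z * w) ≡ x * z * (y * w)
  rearrange = solve-∀

-- One more power of `b` makes up for having only the root rounded down: `suc b` is at most `2 * b`,
-- and `b` absorbs `2 ^ L`.
n<b^ : ∀ {n b} L → 0 < b → 2 ^ L ≤ b → n < suc b ^ L → n < b ^ suc L
n<b^ {n} {b} L 0<b 2^L≤b n< = begin-strict
  n                  <⟨ n< ⟩
  suc b ^ L          ≤⟨ ^-monoˡ-≤ L (+-mono-≤ 0<b (m≤m+n b 0)) ⟩
  (2 * b) ^ L        ≡⟨ ^-*-distribʳ 2 b L ⟩
  2 ^ L * b ^ L      ≤⟨ *-monoˡ-≤ (b ^ L) 2^L≤b ⟩
  b * b ^ L          ∎
  where open ≤-Reasoning

-- Used to assume decidable adjacency on a finite vertex set inside a doubly negated goal.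
¬¬-∀ : ∀ {n} {P : Fin n → Set} → (∀ i → ¬ ¬ P i) → ¬ ¬ (∀ i → P i)
¬¬-∀ {zero}  ¬¬P ¬∀ = ¬∀ λ ()
¬¬-∀ {suc n} ¬¬P ¬∀ = ¬¬P zero λ P₀ → ¬¬-∀ (¬¬P ∘ suc) λ P₊ → ¬∀ λ { zero → P₀ ; (suc i) → P₊ i }

module Parameters (m : ℕ) where
  -- With `b` about `n ^ (1/L)` and `L = 5 * ℓ`, `b ^ p` is about `n ^ (2/5)` and `b ^ g` about
  -- `n ^ (3/5)`. `bound` is chosen so that `b` exceeds every constant that occurs.
  ℓ p g K L bound : ℕ
  ℓ = 2 * suc m
  p = 2 * ℓ
  g = 1 + 3 * ℓ
  K = p + g
  L = 5 * ℓ
  bound = 2 + K + units K (2 * K) + 2 ^ L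

  1≤p : 1 ≤ p
  1≤p = s≤s z≤n

  suc-L≡K : suc L ≡ K
  suc-L≡K = lemma ℓ
    where
    lemma : ∀ ℓ → 1 + 5 * ℓ ≡ 2 * ℓ + (1 + 3 * ℓ)
    lemma = solve-∀

  -- In exponents this is `6 * ℓ + 8 ≤ 6 * ℓ + 12`. The leading terms agree, which is the balance of
  -- `2/5` against `3/5`.
  density : ∀ b → 0 < b → b ^ (2 + p) * b ^ (2 + p) * b ^ (2 + p) * b * b ≤ b ^ (5 + g) * b ^ (5 + g)
  density b 0<b = begin
    x * x * x * b * b                              ≡⟨ lemma₁ x b ⟩
    x * (x * (x * (b * (b * 1))))                  ≡⟨ cong (λ k → x * (x * k)) (^-distribˡ-+-* b (2 + p) 2) ⟨
    x * (x * b ^ (2 + p + 2))                      ≡⟨ cong (x *_) (^-distribˡ-+-* b (2 + p) (2 + p + 2)) ⟨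
    x * b ^ (2 + p + (2 + p + 2))                  ≡⟨ ^-distribˡ-+-* b (2 + p) (2 + p + (2 + p + 2)) ⟨
    b ^ (2 + p + (2 + p + (2 + p + 2)))            ≤⟨ ^-monoʳ-≤ b {{>-nonZero 0<b}} exponents≤ ⟩
    b ^ (5 + g + (5 + g))                          ≡⟨ ^-distribˡ-+-* b (5 + g) (5 + g) ⟩
    b ^ (5 + g) * b ^ (5 + g)                      ∎
    where
    open ≤-Reasoning
    x = b ^ (2 + p)
    lemma₁ : ∀ x b → x * x * x * b * b ≡ x * (x * (x * (b * (b * 1))))
    lemma₁ = solve-∀
    lemma₂ : ∀ ℓ → 2 + 2 * ℓ + (2 + 2 * ℓ + (2 + 2 * ℓ + 2)) + 4 ≡ 5 + (1 + 3 * ℓ) + (5 + (1 + 3 * ℓ))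
    lemma₂ = solve-∀
    exponents≤ : 2 + p + (2 + p + (2 + p + 2)) ≤ 5 + g + (5 + g)
    exponents≤ = m+n≤o⇒m≤o _ {4} (≤-reflexive (lemma₂ ℓ))

  -- `b ^ (6 + g)` is at most `n` to the power `3/5 + 7/(5ℓ)`, and `ℓ = 2 * suc m` makes `7/(5ℓ)`
  -- smaller than `1/(m+1)`.
  final : ∀ {b n k} → 2 ≤ b → b ^ L ≤ n → k ≤ b * b ^ (5 + g) → k ^ (5 * suc m) < n ^ (3 * suc m + 5)
  final {b} {n} {k} 2≤b b^L≤n k≤ = begin-strict
    k ^ (5 * suc m)                        ≤⟨ ^-monoˡ-≤ (5 * suc m) k≤ ⟩
    (b ^ (6 + g)) ^ (5 * suc m)            ≡⟨ ^-*-assoc b (6 + g) (5 * suc m) ⟩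
    b ^ ((6 + g) * (5 * suc m))            <⟨ ^-monoʳ-< b 2≤b exponents< ⟩
    b ^ (L * (3 * suc m + 5))              ≡⟨ ^-*-assoc b L (3 * suc m + 5) ⟨
    (b ^ L) ^ (3 * suc m + 5)              ≤⟨ ^-monoˡ-≤ (3 * suc m + 5) b^L≤n ⟩
    n ^ (3 * suc m + 5)                    ∎
    where
    open ≤-Reasoning
    lemma : ∀ s → (6 + (1 + 3 * (2 * s))) * (5 * s) + 15 * s ≡ 5 * (2 * s) * (3 * s + 5)
    lemma = solve-∀
    exponents< : (6 + g) * (5 * suc m) < L * (3 * suc m + 5)
    exponents< = ≤-trans (m<m+n _ {15 * suc m} (s≤s z≤n)) (≤-reflexive (lemma (suc m)))

  few-cops-win : ∀ {n} → bound ^ L ≤ n → (G : Graph n) → DiamAtMost G 4 → (∀ u v → Dec (Adj G u v)) →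
                 ∃[ k ] CopsWin G k × k ^ (5 * suc m) < n ^ (3 * suc m + 5)
  few-cops-win {n} N≤n G diam adj? =
    let (b , b^L≤n , n<) = root n L (s≤s z≤n)
        bound≤b : bound ≤ b
        bound≤b = ≮⇒≥ λ b< → <⇒≱ n< (≤-trans (^-monoˡ-≤ L b<) N≤n)
        K+2≤b = ≤-trans (m≤m+n (2 + K) (units K (2 * K))) (≤-trans (m≤m+n _ (2 ^ L)) bound≤b)
        2≤b = ≤-trans (m≤m+n 2 K) K+2≤b
        0<b = ≤-trans (s≤s z≤n) 2≤b
        units≤b = ≤-trans (m≤n+m (units K (2 * K)) (2 + K)) (≤-trans (m≤m+n _ (2 ^ L)) bound≤b)
        2^L≤b = ≤-trans (m≤n+m (2 ^ L) (2 + K + units K (2 * K))) bound≤b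
        0<n = ≤-trans (m^n>0 b {{>-nonZero 0<b}} L) b^L≤n
        n<b^K = subst (λ k → n < b ^ k) suc-L≡K (n<b^ L 0<b 2^L≤b n<)
    in units K (2 * K) * b ^ (5 + g) ,
       Game.cops-win G adj? 0<n diam 2≤b 1≤p n<b^K K+2≤b (density b 0<b) ,
       final 2≤b b^L≤n (*-monoˡ-≤ (b ^ (5 + g)) units≤b)

-- The inequality says that `c` is below `n` to the power `3/5 + 1/(m+1)`. Having it for every `m`
-- and all large `n` is the meaning of the term `o(1)`.
theorem6 : ∀ (m : ℕ) → ∃[ N ] (∀ (n : ℕ) → N ≤ n → (G : Graph n) → DiamAtMost G 4 →
    ∀ (c : ℕ) → IsCopNumber G c → c ^ (5 * suc m) < n ^ (3 * suc m + 5))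
theorem6 m = bound ^ L , λ n N≤n G diam c (_ , minimal) →
  -- The goal is a decidable inequality, so it may be proved under a double negation, where
  -- adjacency can be taken to be decidable.
  decidable-stable (c ^ (5 * suc m) <? n ^ (3 * suc m + 5)) λ c≮ →
    ¬¬-∀ (λ u → ¬¬-∀ λ v → ¬¬-excluded-middle) λ adj? →
      let (k , cops-win , k<) = few-cops-win N≤n G diam adj?
          c≤k = ≮⇒≥ λ k<c → minimal k k<c cops-win
      in c≮ (≤-<-trans (^-monoˡ-≤ (5 * suc m) c≤k) k<)
  where open Parameters m
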